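{- Let $n,m\ge1$ and let $T$ be a triangulation of the annulus $A_{n,m}$, with outer quiddity sequence $q$ (of length $n$) and inner quiddity sequence $\bar q$ (of length $m$). Let $\mathcal{F}=(m_{i,j})$ and $\bar{\mathcal{F}}=(\bar m_{i,j})$ be the associated outer and inner friezes, i.e. the periodic infinite friezes of positive integers generated by $q$ and $\bar q$. Then $s_q=s_{\bar q}$.
   Context: An infinite frieze of positive integers is an array $(m_{i,j})$, indexed by $i\in\mathbb{Z}$ and $j\ge i-2$, with $m_{i,i-2}=0$, $m_{i,i-1}=1$, with $m_{i,j}$ a positive integer for $j\ge i-1$, and with $m_{i,j}m_{i+1,j+1}-m_{i,j+1}m_{i+1,j}=1$ for all $i$ and all $j\ge i-1$. Its quiddity row is $(a_i)_{i\in\mathbb{Z}}$, $a_i=m_{i,i}$, which determines the frieze (via $m_{i,j}=a_jm_{i,j-1}-m_{i,j-2}$). A finite sequence $q=(a_1,\dots,a_n)$ generates the frieze whose quiddity row is the $n$-periodic repetition of $q$. For such $q$ put $s_q:=m_{1,n}-m_{2,n-1}$; likewise $s_{\bar q}:=\bar m_{1,m}-\bar m_{2,m-1}$ for $\bar q$ of length $m$. The sequences $q$, $\bar q$ are taken exactly as they come from the triangulation (of lengths $n$ and $m$), irrespective of their minimal periods. $A_{n,m}$ is the annulus with $n$ marked points on its outer boundary and $m$ marked points on its inner boundary. A triangulation is a maximal collection of pairwise non-crossing (non-self-crossing) arcs, up to isotopy, with endpoints at marked points, none of which is contractible or isotopic to a boundary segment; loops are allowed. Label the vertices of the outer and inner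 boundaries anti-clockwise by $1,\dots,n$ and $1,\dots,m$. The outer quiddity sequence is $q=(a_1,\dots,a_n)$, where $a_i$ is the number of triangles incident with the outer vertex $i$, counted locally (in a small neighbourhood of the vertex, i.e. $a_i$ is one plus the number of ends of arcs of $T$ at vertex $i$). The inner quiddity sequence $\bar q=(\bar a_1,\dots,\bar a_m)$ is defined in the same way from the inner vertices. It is known that both $q$ and $\bar q$ generate infinite friezes of positive integers. -}

module Defs where

open import Data.Empty using (⊥)
open import Data.Fin.Base using (Fin; toℕ)
open import Data.Integer.Base
  using (ℤ; +_; _+_; _-_; _*_; _<_; _≤_; 0ℤ; 1ℤ)
open import Data.Integer.Divisibility.Signed using (_∣_; _∣?_)
open import Data.List.Base using (List; []; _∷_; length; filter; concatMap)
open import Data.List.Membership.Propositional using (_∈_)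
open import Data.List.Relation.Unary.Unique.Propositional using (Unique)
open import Data.Nat.Base as ℕ using (ℕ; suc)
open import Data.Product.Base using (_×_; ∃₂)
open import Data.Sum.Base using (_⊎_)
open import Level using (0ℓ)
open import Relation.Binary.PropositionalEquality using (_≡_)
open import Relation.Nullary.Decidable using (Dec)
open import Relation.Nullary.Negation using (¬_)
open import Relation.Unary using (Pred; _⊆_)

-- The array is indexed by j ≥ i - 2; the values of `entry i j` with
-- j < i - 2 are unconstrained and play no role.
record InfiniteFrieze : Set where
  field
    entry      : ℤ → ℤ → ℤ
    zeros      : ∀ i → entry i (i - + 2) ≡ 0ℤ
    ones       : ∀ i → entry i (i - 1ℤ) ≡ 1ℤ
    positive   : ∀ i j → i - 1ℤ ≤ j → 0ℤ < entry i j
    unimodular : ∀ i j → i - 1ℤ ≤ j →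
      entry i j * entry (i + 1ℤ) (j + 1ℤ)
        - entry i (j + 1ℤ) * entry (i + 1ℤ) j ≡ 1ℤ

  quiddityRow : ℤ → ℤ
  quiddityRow i = entry i i

-- The vertices 1, …, n of a boundary circle are the elements of Fin n, so
-- labels are shifted by one.
label : ∀ {n} → Fin n → ℤ
label v = + suc (toℕ v)

-- The integer p, as a point of the universal cover ℤ of ℤ / n, lies over v.
_LiesOver_ : ∀ {n} → ℤ → Fin n → Set
_LiesOver_ {n} p v = + n ∣ p - label v

liesOver? : ∀ {n} (v : Fin n) (p : ℤ) → Dec (p LiesOver v)
liesOver? {n} v p = + n ∣? p - label v

-- The quiddity row of F is the n-periodic repetition of q.
_GeneratedBy_ : InfiniteFrieze → ∀ {n} → (Fin n → ℕ) → Set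
_GeneratedBy_ F {n} q =
  ∀ (i : ℤ) (v : Fin n) → i LiesOver v → InfiniteFrieze.quiddityRow F i ≡ + q v

-- m_{1,n} - m_{2,n-1}
s : ℕ → InfiniteFrieze → ℤ
s n F = entry 1ℤ (+ n) - entry (+ 2) (+ n - 1ℤ)
  where open InfiniteFrieze F

data Side : Set where
  outer inner : Side

-- The universal cover of the annulus is a strip whose two boundary lines carry
-- the lifted marked points, one for each integer, increasing anti-clockwise on
-- both lines. Up to isotopy a curve in the strip between marked points is
-- determined by its two endpoints.
data StripCurve : Set where
  -- both endpoints on the given line, the smaller one first
  chord  : Side → ℤ → ℤ → StripCurve
  -- an endpoint on the outer line and an endpoint on the inner line
  bridge : ℤ → ℤ → StripCurve

Interlaced : ℤ → ℤ → ℤ → ℤ → Set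
Interlaced a b c d = (a < c × c < b × b < d) ⊎ (c < a × a < d × d < b)

-- The endpoints of the two curves separate each other on the boundary of the
-- strip, i.e. the curves meet in the interior however they are drawn.
StripCrosses : StripCurve → StripCurve → Set
StripCrosses (chord outer a b) (chord outer c d) = Interlaced a b c d
StripCrosses (chord inner a b) (chord inner c d) = Interlaced a b c d
StripCrosses (chord outer _ _) (chord inner _ _) = ⊥
StripCrosses (chord inner _ _) (chord outer _ _) = ⊥
StripCrosses (chord outer a b) (bridge c _)      = a < c × c < b
StripCrosses (chord inner a b) (bridge _ d)      = a < d × d < b
StripCrosses (bridge c _)      (chord outer a b) = a < c × c < b
StripCrosses (bridge _ d)      (chord inner a b) = a < d × d < b
StripCrosses (bridge a b)      (bridge c d)      =
  (a < c × d < b) ⊎ (c < a × b < d)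

module _ (n m : ℕ) where

  size : Side → ℕ
  size outer = n
  size inner = m

  -- Isotopy classes of (possibly self-crossing) curves between marked points of
  -- A_{n,m} that are neither contractible nor isotopic to a boundary segment.
  -- Each class has exactly one representative: an orbit of strip curves under
  -- the deck group ℤ, given by its member with (first, or outer) endpoint at a
  -- label in 1, …, size. A self-crossing curve is one that crosses itself in
  -- the sense of `Crosses` below.
  data Curve : Set where
    -- from v anti-clockwise along its boundary component to the k-th next
    -- marked point, possibly winding around; k = 0 is contractible and k = 1 is
    -- a boundary segment
    peripheral : (σ : Side) (v : Fin (size σ)) (k : ℕ) → .(2 ℕ.≤ k) → Curve
    -- from the outer vertex v to the lifted inner marked point j
    bridging   : (v : Fin n) (j : ℤ) → Curve

  lift : ℤ → Curve → StripCurve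
  lift t (peripheral σ v k _) =
    chord σ (label v + t * + size σ) (label v + + k + t * + size σ)
  lift t (bridging v j) = bridge (label v + t * + n) (j + t * + m)

  Crosses : Curve → Curve → Set
  Crosses γ δ = ∃₂ λ t u → StripCrosses (lift t γ) (lift u δ)

  -- The case γ = δ excludes self-crossing curves.
  NonCrossing : Pred Curve 0ℓ → Set
  NonCrossing C = ∀ γ δ → C γ → C δ → ¬ Crosses γ δ

  -- The collection is listed without repetition, as arc ends are counted;
  -- non-crossing collections of arcs in A_{n,m} are finite. Maximality is among
  -- all collections.
  record Triangulation : Set₁ where
    field
      arcs        : List Curve
      unique      : Unique arcs
      nonCrossing : NonCrossing (_∈ arcs)
      maximal     : ∀ (C : Pred Curve 0ℓ) → NonCrossing C →
                    (_∈ arcs) ⊆ C → C ⊆ (_∈ arcs)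

module _ {n m : ℕ} where

  -- Lifted positions of the ends of a curve on the given boundary component.
  ends : Side → Curve n m → List ℤ
  ends outer (peripheral outer v k _) = label v ∷ label v + + k ∷ []
  ends inner (peripheral inner v k _) = label v ∷ label v + + k ∷ []
  ends outer (peripheral inner _ _ _) = []
  ends inner (peripheral outer _ _ _) = []
  ends outer (bridging v _)           = label v ∷ []
  ends inner (bridging _ j)           = j ∷ []

  -- One plus the number of ends of arcs at v, i.e. the number of triangles at v
  -- counted locally; a loop at v contributes two ends.
  quiddity : Triangulation n m → (σ : Side) → Fin (size n m σ) → ℕ
  quiddity T σ v =
    suc (length (filter (liesOver? v) (concatMap (ends σ) arcs)))
    where open Triangulation T

  outerQuiddity : Triangulation n m → Fin n → ℕ
  outerQuiddity T = quiddity T outer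

  innerQuiddity : Triangulation n m → Fin m → ℕ
  innerQuiddity T = quiddity T inner

{-# OPTIONS --safe #-}

-- Lift the triangulation T to the strip, and let p be a solution of the
-- recurrence p (i + 1) + p (i - 1) = a i · p i given by one of the quiddity
-- rows. In the polygon cut off by a chord from a to b one gets
-- p b = p (a + 1) - k · p a, with k the number of triangles at a; a
-- triangle with base on the line of p therefore extends p consistently across
-- the strip, and for a bridge (x , y) the value F at y of this extension is
-- f · p x - p (x - 1), with f the number of triangles at x to the left of the
-- bridge. Moving to the next bridge, (p x , F) becomes (p x + F , F) if the
-- outer end moves and (p x , F + p x) if the inner end moves; seen from the
-- inner line the two rules are exchanged. A walk from a bridge to its
-- translate by the deck transformation thus acts by matrices
-- (α β ; γ δ) and (δ γ ; β α), whose common trace is s of either frieze.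
module Submission where

open import Defs
open import Data.Nat.Base using (ℕ; _≤_)
open import Relation.Binary.PropositionalEquality using (_≡_)

open import Data.Bool.Base using (if_then_else_)
open import Data.Empty using (⊥; ⊥-elim)
open import Data.Fin.Base using (Fin; toℕ; fromℕ<)
open import Data.Fin.Properties using (toℕ<n; toℕ-fromℕ<; toℕ-injective)
open import Data.Integer.Base as ℤ
  using (ℤ; +_; -[1+_]; _+_; _-_; _*_; -_; 0ℤ; 1ℤ; -1ℤ; pred; _<_)
  renaming (suc to sucℤ)
import Data.Integer.DivMod as ℤ
import Data.Integer.Properties as ℤ
open import Algebra.Properties.AbelianGroup ℤ.+-0-abelianGroup using ()
  renaming (∙-cancelˡ to +-cancelˡ; ∙-cancelʳ to +-cancelʳ)
open import Data.Integer.Divisibility.Signed using (_∣?_; divides)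
open import Data.Integer.Tactic.RingSolver using (solve-∀)
open import Data.List.Base using (List; []; _∷_; map; length; filter; concatMap)
open import Data.List.Extrema.Nat using (argmax; argmax-sel; f[xs]≤f[argmax]; f[⊥]≤f[argmax])
open import Data.List.Membership.Propositional using (_∈_; find; lose)
open import Data.List.Membership.Propositional.Properties using (∈-concatMap⁺; ∈-concatMap⁻)
import Data.List.Properties as List
open import Data.List.Relation.Unary.All as All using (All; []; _∷_)
import Data.List.Relation.Unary.All.Properties as All
open import Data.List.Relation.Unary.AllPairs as AllPairs using (AllPairs; []; _∷_)
import Data.List.Relation.Unary.AllPairs.Properties as AllPairs
open import Data.List.Relation.Unary.Any using (here; there; any?)
open import Data.List.Relation.Unary.Unique.Propositional using (Unique)
import Data.List.Relation.Unary.Unique.Propositional.Properties as Unique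
open import Data.Nat.Base as ℕ using (zero; suc)
open import Data.Nat.ListAction using (sum)
import Data.Nat.Properties as ℕ
open import Algebra.Properties.CommutativeSemigroup ℕ.+-commutativeSemigroup using (interchange)
open import Data.Product.Base using (_×_; _,_; proj₁; proj₂; ∃; ∃₂)
open import Data.Sum.Base as Sum using (_⊎_; inj₁; inj₂)
open import Data.Unit.Base using (⊤; tt)
open import Relation.Binary.Definitions using (tri<; tri≈; tri>)
open import Relation.Binary.PropositionalEquality
  using (refl; sym; trans; cong; cong₂; subst; subst₂; _≢_; module ≡-Reasoning)
open import Relation.Nullary.Decidable using (Dec; yes; no; does; recompute; _×-dec_)
open import Relation.Nullary.Negation using (¬_)

-- Linear recurrences over ℤ

-- `s` is a trace because rows 1 and 2 of a frieze are, up to a shift and a sign, a basis of the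
-- solutions of its recurrence, and `s` sums the diagonal entries of the translation by one period
-- in that basis. No solution on one line is identified with a solution on the other: each line is
-- followed along the same walk, and only the resulting matrices are compared. All rules along the
-- walk are instances of one. Order the vertices of the strip to the right along the outer line and
-- back along the inner line; in each triangle the value at the middle vertex is then the sum of the
-- other two. The recurrence at a vertex knows its triangles only through their number, so this rule
-- has to come from splitting the arc ends at the vertex exactly into those before, inside and after
-- a given triangle. The triangles are not part of the data. Each is produced from maximality: take
-- a furthest neighbour and show that neither an arc nor a translate of the missing side crosses
-- that side.

ℤ-induction : (P : ℤ → Set) → P 0ℤ → (∀ i → P i → P (sucℤ i)) →
  (∀ i → P (sucℤ i) → P i) → ∀ i → P i
ℤ-induction P base up down (+ zero)      = base
ℤ-induction P base up down (+ suc k)     = up (+ k) (ℤ-induction P base up down (+ k))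
ℤ-induction P base up down -[1+ zero ]   = down -[1+ 0 ] base
ℤ-induction P base up down -[1+ suc k ]  = down -[1+ suc k ] (ℤ-induction P base up down -[1+ k ])

record Solution (a p : ℤ → ℤ) : Set where
  constructor solves
  field recurrence : ∀ i → p (sucℤ i) + p (pred i) ≡ a i * p i
open Solution

module _ {a p : ℤ → ℤ} (sol : Solution a p) where

  next : ∀ i → p (sucℤ i) ≡ a i * p i - p (pred i)
  next i = trans (e (p (sucℤ i)) (p (pred i))) (cong (_- p (pred i)) (recurrence sol i))
    where e : ∀ x y → x ≡ (x + y) - y
          e = solve-∀

  previous : ∀ i → p i ≡ a (sucℤ i) * p (sucℤ i) - p (sucℤ (sucℤ i))
  previous i = begin
    p i                                                       ≡⟨ e (p i) (p (sucℤ (sucℤ i))) ⟩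
    (p (sucℤ (sucℤ i)) + p i) - p (sucℤ (sucℤ i))             ≡⟨ cong (λ j → (p (sucℤ (sucℤ i)) + p j) - p (sucℤ (sucℤ i))) (ℤ.pred-suc i) ⟨
    (p (sucℤ (sucℤ i)) + p (pred (sucℤ i))) - p (sucℤ (sucℤ i)) ≡⟨ cong (_- p (sucℤ (sucℤ i))) (recurrence sol (sucℤ i)) ⟩
    a (sucℤ i) * p (sucℤ i) - p (sucℤ (sucℤ i))               ∎
    where open ≡-Reasoning
          e : ∀ x y → x ≡ (y + x) - y
          e = solve-∀

solution-unique : ∀ {a p r} → Solution a p → Solution a r →
  p 0ℤ ≡ r 0ℤ → p 1ℤ ≡ r 1ℤ → ∀ i → p i ≡ r i
solution-unique {a} {p} {r} sp sr eq₀ eq₁ i = proj₁ (ℤ-induction Agree (eq₀ , eq₁) up down i)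
  where
  Agree : ℤ → Set
  Agree i = p i ≡ r i × p (sucℤ i) ≡ r (sucℤ i)

  up : ∀ i → Agree i → Agree (sucℤ i)
  up i (e , e′) = e′ , (begin
    p (sucℤ (sucℤ i))                                 ≡⟨ next sp (sucℤ i) ⟩
    a (sucℤ i) * p (sucℤ i) - p (pred (sucℤ i))       ≡⟨ cong₂ (λ x y → a (sucℤ i) * x - y) e′ e″ ⟩
    a (sucℤ i) * r (sucℤ i) - r (pred (sucℤ i))       ≡⟨ next sr (sucℤ i) ⟨
    r (sucℤ (sucℤ i))                                 ∎)
    where open ≡-Reasoning
          e″ : p (pred (sucℤ i)) ≡ r (pred (sucℤ i))
          e″ = subst (λ j → p j ≡ r j) (sym (ℤ.pred-suc i)) e

  down : ∀ i → Agree (sucℤ i) → Agree i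
  down i (e , e′) =
    trans (previous sp i) (trans (cong₂ (λ x y → a (sucℤ i) * x - y) e e′) (sym (previous sr i))) , e

module InitialValues (a : ℤ → ℤ) (u v : ℤ) where

  -- Carrying neighbouring values makes the recursion structural in both directions: `above k` is (p
  -- k , p (k + 1)) and `below k` is (p (- k) , p (1 - k)).
  above : ℕ → ℤ × ℤ
  above zero    = u , v
  above (suc k) = let (x , y) = above k in y , a (+ suc k) * y - x

  below : ℕ → ℤ × ℤ
  below zero    = u , v
  below (suc k) = let (x , y) = below k in a (ℤ.- + k) * x - y , x

  solution : ℤ → ℤ
  solution (+ k)    = proj₁ (above k)
  solution -[1+ k ] = proj₁ (below (suc k))

  isSolution : Solution a solution
  isSolution = solves λ where
      (+ zero)     → above-below v (a 0ℤ * u)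
      (+ suc k)    → below-above (a (+ suc k) * proj₂ (above k)) (proj₁ (above k))
      -[1+ zero ]  → above-below u (a -[1+ 0 ] * solution -[1+ 0 ])
      -[1+ suc k ] → above-below (proj₁ (below (suc k))) (a -[1+ suc k ] * solution -[1+ suc k ])
    where
    above-below : ∀ x y → x + (y - x) ≡ y
    above-below = solve-∀
    below-above : ∀ x y → (x - y) + y ≡ x
    below-above = solve-∀

open InitialValues using (solution; isSolution)

combination : ∀ {a p r} → Solution a p → Solution a r → ∀ α β → Solution a (λ i → α * p i + β * r i)
combination {a} {p} {r} sp sr α β = solves λ i →
  trans (e α β (p (sucℤ i)) (r (sucℤ i)) (p (pred i)) (r (pred i)))
    (trans (cong₂ (λ x y → α * x + β * y) (recurrence sp i) (recurrence sr i)) (e′ α β (a i) (p i) (r i)))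
  where e : ∀ α β x y z w → α * x + β * y + (α * z + β * w) ≡ α * (x + z) + β * (y + w)
        e = solve-∀
        e′ : ∀ α β k x y → α * (k * x) + β * (k * y) ≡ k * (α * x + β * y)
        e′ = solve-∀

Periodic : ℤ → (ℤ → ℤ) → Set
Periodic n a = ∀ i → a (i + n) ≡ a i

translate : ∀ {n a p} → Periodic n a → Solution a p → Solution a (λ i → p (i + n))
translate {n} {a} {p} per sp = solves λ i → begin
  p (sucℤ i + n) + p (pred i + n)     ≡⟨ cong₂ (λ j k → p j + p k) (ℤ.+-assoc 1ℤ i n) (ℤ.+-assoc -1ℤ i n) ⟩
  p (sucℤ (i + n)) + p (pred (i + n)) ≡⟨ recurrence sp (i + n) ⟩
  a (i + n) * p (i + n)               ≡⟨ cong (_* p (i + n)) (per i) ⟩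
  a i * p (i + n)                     ∎
  where open ≡-Reasoning

-- The trace of the monodromy on solutions, in the basis with initial values
-- (p 0 , p 1) = (0 , 1) and (1 , 0), is the trace in any other coordinates.
module Monodromy {n : ℤ} {a : ℤ → ℤ} (per : Periodic n a) where

  e g : ℤ → ℤ
  e = solution a 0ℤ 1ℤ
  g = solution a 1ℤ 0ℤ

  se : Solution a e
  se = isSolution a 0ℤ 1ℤ
  sg : Solution a g
  sg = isSolution a 1ℤ 0ℤ

  -- One step of the recurrence has determinant 1, so this determinant is constant in i and can be
  -- read off at 0.
  wronskian : ∀ i → e i * g (pred i) - g i * e (pred i) ≡ 1ℤ
  wronskian = ℤ-induction _ (base (a 0ℤ)) (λ i h → trans (step i) h) (λ i h → trans (sym (step i)) h)
    where
    base : ∀ x → 0ℤ * (x * 1ℤ - 0ℤ) - 1ℤ * (x * 0ℤ - 1ℤ) ≡ 1ℤ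
    base = solve-∀
    id : ∀ a x y z w → (a * x - z) * y - (a * y - w) * x ≡ x * w - y * z
    id = solve-∀
    step : ∀ i → e (sucℤ i) * g (pred (sucℤ i)) - g (sucℤ i) * e (pred (sucℤ i))
               ≡ e i * g (pred i) - g i * e (pred i)
    step i = begin
      e (sucℤ i) * g (pred (sucℤ i)) - g (sucℤ i) * e (pred (sucℤ i))
        ≡⟨ cong (λ j → e (sucℤ i) * g j - g (sucℤ i) * e j) (ℤ.pred-suc i) ⟩
      e (sucℤ i) * g i - g (sucℤ i) * e i
        ≡⟨ cong₂ (λ x y → x * g i - y * e i) (next {p = e} se i) (next {p = g} sg i) ⟩
      (a i * e i - e (pred i)) * g i - (a i * g i - g (pred i)) * e i
        ≡⟨ id (a i) (e i) (g i) (e (pred i)) (g (pred i)) ⟩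
      e i * g (pred i) - g i * e (pred i) ∎
      where open ≡-Reasoning

  decompose : ∀ {p} → Solution a p → ∀ i → p i ≡ p 1ℤ * e i + p 0ℤ * g i
  decompose {p} sp = solution-unique sp
    (combination se sg (p 1ℤ) (p 0ℤ))
    (e₀ (p 1ℤ) (p 0ℤ)) (e₁ (p 1ℤ) (p 0ℤ))
    where e₀ : ∀ x y → y ≡ x * 0ℤ + y * 1ℤ
          e₀ = solve-∀
          e₁ : ∀ x y → x ≡ x * 1ℤ + y * 0ℤ
          e₁ = solve-∀

  -- Let B have rows (E , G) and (E′ , G′), the coordinates of the basis `e`, `g`. For any M,
  -- replacing one row of B by the same row of M B and summing the two determinants gives tr M · det
  -- B. Here M B = B K, with K the monodromy in the basis, so tr K · det B is the same sum, and det
  -- B is invertible.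
  trace : ∀ (x f : ℤ) {α β γ δ} →
    let F : (ℤ → ℤ) → ℤ → ℤ
        F p i = f * p i - p (pred i) in
    (∀ p → Solution a p → p (x + n) ≡ α * p x + β * F p x) →
    (∀ p → Solution a p → F p (x + n) ≡ γ * p x + δ * F p x) →
    α + δ ≡ e (1ℤ + n) + g (0ℤ + n)
  trace x f {α} {β} {γ} {δ} h₁ h₂ = ℤ.*-cancelʳ-≡ _ _ D {{≢}} (begin
    (α + δ) * D ≡⟨ id₁ α β γ δ E E′ G G′ ⟩
    (α * E + β * E′) * G′ - (α * G + β * G′) * E′ + (E * (γ * G + δ * G′) - G * (γ * E + δ * E′))
      ≡⟨ cong₂ _+_ (cong₂ _-_ (cong (_* G′) (sym eq₁)) (cong (_* E′) (sym eq₂)))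
                   (cong₂ _-_ (cong (E *_) (sym eq₄)) (cong (G *_) (sym eq₃))) ⟩
    (ε₁ * E + ε₀ * G) * G′ - (η₁ * E + η₀ * G) * E′ + (E * (η₁ * E′ + η₀ * G′) - G * (ε₁ * E′ + ε₀ * G′))
      ≡⟨ id₂ ε₁ ε₀ η₁ η₀ E E′ G G′ ⟩
    (ε₁ + η₀) * D ∎)
    where
    open ≡-Reasoning
    F : (ℤ → ℤ) → ℤ → ℤ
    F p i = f * p i - p (pred i)
    E = e x ; E′ = F e x ; G = g x ; G′ = F g x
    D = E * G′ - G * E′
    ε₁ = e (1ℤ + n) ; ε₀ = e (0ℤ + n)
    η₁ = g (1ℤ + n) ; η₀ = g (0ℤ + n)

    monodromy : ∀ {p} → Solution a p → ∀ i → p (i + n) ≡ p (1ℤ + n) * e i + p (0ℤ + n) * g i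
    monodromy sp = decompose (translate per sp)

    F-monodromy : ∀ {p} → Solution a p → F p (x + n) ≡ p (1ℤ + n) * E′ + p (0ℤ + n) * G′
    F-monodromy {p} sp = begin
      f * p (x + n) - p (pred (x + n)) ≡⟨ cong (λ j → f * p (x + n) - p j) (ℤ.+-assoc -1ℤ x n) ⟨
      f * p (x + n) - p (pred x + n)   ≡⟨ cong₂ (λ y z → f * y - z) (monodromy sp x) (monodromy sp (pred x)) ⟩
      f * (p (1ℤ + n) * E + p (0ℤ + n) * G) - (p (1ℤ + n) * e (pred x) + p (0ℤ + n) * g (pred x))
        ≡⟨ id f (p (1ℤ + n)) (p (0ℤ + n)) E G (e (pred x)) (g (pred x)) ⟩
      p (1ℤ + n) * E′ + p (0ℤ + n) * G′ ∎
      where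
      id : ∀ f x y E G c d → f * (x * E + y * G) - (x * c + y * d) ≡ x * (f * E - c) + y * (f * G - d)
      id = solve-∀

    eq₁ : ε₁ * E + ε₀ * G ≡ α * E + β * E′
    eq₁ = trans (sym (monodromy se x)) (h₁ e se)
    eq₂ : η₁ * E + η₀ * G ≡ α * G + β * G′
    eq₂ = trans (sym (monodromy sg x)) (h₁ g sg)
    eq₃ : ε₁ * E′ + ε₀ * G′ ≡ γ * E + δ * E′
    eq₃ = trans (sym (F-monodromy se)) (h₂ e se)
    eq₄ : η₁ * E′ + η₀ * G′ ≡ γ * G + δ * G′
    eq₄ = trans (sym (F-monodromy sg)) (h₂ g sg)

    id₁ : ∀ α β γ δ E E′ G G′ → (α + δ) * (E * G′ - G * E′) ≡
      (α * E + β * E′) * G′ - (α * G + β * G′) * E′ + (E * (γ * G + δ * G′) - G * (γ * E + δ * E′))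
    id₁ = solve-∀
    id₂ : ∀ a b c d E E′ G G′ →
      (a * E + b * G) * G′ - (c * E + d * G) * E′ + (E * (c * E′ + d * G′) - G * (a * E′ + b * G′))
      ≡ (a + d) * (E * G′ - G * E′)
    id₂ = solve-∀

    -- The multiple f of the first coordinate drops out of the determinant, which leaves minus the
    -- Wronskian.
    D≡-1 : D ≡ -1ℤ
    D≡-1 = trans (id f E G (e (pred x)) (g (pred x))) (cong -_ (wronskian x))
      where
      id : ∀ f E G c d → E * (f * G - d) - G * (f * E - c) ≡ - (E * d - G * c)
      id = solve-∀
    ≢ : ℤ.NonZero D
    ≢ = subst ℤ.NonZero (sym D≡-1) _

-- Rows of a frieze

module Rows (F : InfiniteFrieze) where
  open InfiniteFrieze F

  -- Subtracting the unimodular relations of two adjacent squares gives X (m i j + m i (j - 2)) = m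
  -- i (j - 1) · (Y + Z). Row i + 1 is closer to the diagonal at j, so by induction Y + Z is the
  -- quiddity times X, and X is positive and cancels.
  row-recurrence : ∀ k i j → j ≡ i + + k →
    entry i j + entry i (j - + 2) ≡ quiddityRow j * entry i (j - 1ℤ)
  row-recurrence zero i j j≡i+0 rewrite trans j≡i+0 (ℤ.+-identityʳ i) | zeros i | ones i =
    id (entry i i)
    where id : ∀ x → x + 0ℤ ≡ x * 1ℤ
          id = solve-∀
  row-recurrence (suc k) i j j≡ = ℤ.*-cancelˡ-≡ X _ _ {{ℤ.>-nonZero (positive (i + 1ℤ) (j - 1ℤ) X≥)}} (begin
    X * (entry i j + entry i (j - + 2))   ≡⟨ id₁ (entry i j) (entry i (j - + 2)) (entry i (j - 1ℤ)) X Y Z u₁ u₂ ⟩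
    entry i (j - 1ℤ) * (Y + Z)            ≡⟨ cong (entry i (j - 1ℤ) *_) (row-recurrence k (i + 1ℤ) j (trans j≡ (shift i (+ k)))) ⟩
    entry i (j - 1ℤ) * (quiddityRow j * X) ≡⟨ id₂ (entry i (j - 1ℤ)) (quiddityRow j) X ⟩
    X * (quiddityRow j * entry i (j - 1ℤ)) ∎)
    where
    open ≡-Reasoning
    X = entry (i + 1ℤ) (j - 1ℤ)
    Y = entry (i + 1ℤ) j
    Z = entry (i + 1ℤ) (j - + 2)
    shift : ∀ i k → i + (1ℤ + k) ≡ i + 1ℤ + k
    shift = solve-∀
    X≥ : i + 1ℤ - 1ℤ ℤ.≤ j - 1ℤ
    X≥ = ℤ.+-monoˡ-≤ (- 1ℤ) (ℤ.≤-trans (ℤ.+-monoʳ-≤ i (ℤ.+≤+ (ℕ.s≤s ℕ.z≤n))) (ℤ.≤-reflexive (sym j≡)))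
    low : i - 1ℤ ℤ.≤ j - + 2
    low = ℤ.≤-trans (ℤ.≤-reflexive (e i)) (ℤ.+-monoˡ-≤ (- + 2) (ℤ.≤-trans (ℤ.+-monoʳ-≤ i (ℤ.+≤+ (ℕ.s≤s ℕ.z≤n))) (ℤ.≤-reflexive (sym j≡))))
      where e : ∀ i → i - 1ℤ ≡ (i + 1ℤ) - + 2
            e = solve-∀
    low′ : i - 1ℤ ℤ.≤ j - 1ℤ
    low′ = ℤ.+-monoˡ-≤ (- 1ℤ) (ℤ.≤-trans (ℤ.i≤i+j i (+ suc k)) (ℤ.≤-reflexive (sym j≡)))
    j-1+1 : ∀ j → j - 1ℤ + 1ℤ ≡ j
    j-1+1 = solve-∀
    j-2+1 : ∀ j → j - + 2 + 1ℤ ≡ j - 1ℤ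
    j-2+1 = solve-∀
    u₁ : entry i (j - 1ℤ) * Y - entry i j * X ≡ 1ℤ
    u₁ = subst (λ l → entry i (j - 1ℤ) * entry (i + 1ℤ) l - entry i l * X ≡ 1ℤ) (j-1+1 j) (unimodular i (j - 1ℤ) low′)
    u₂ : entry i (j - + 2) * X - entry i (j - 1ℤ) * Z ≡ 1ℤ
    u₂ = subst (λ l → entry i (j - + 2) * entry (i + 1ℤ) l - entry i l * Z ≡ 1ℤ) (j-2+1 j) (unimodular i (j - + 2) low)
    id₁ : ∀ a c b X Y Z → b * Y - a * X ≡ 1ℤ → c * X - b * Z ≡ 1ℤ → X * (a + c) ≡ b * (Y + Z)
    id₁ a c b X Y Z h h′ = trans (l₁ a c b X Y Z) (trans (cong₂ (λ x y → b * (Y + Z) + (y - x)) h h′) (l₂ (b * (Y + Z))))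
      where l₁ : ∀ a c b X Y Z → X * (a + c) ≡ b * (Y + Z) + ((c * X - b * Z) - (b * Y - a * X))
            l₁ = solve-∀
            l₂ : ∀ x → x + (1ℤ - 1ℤ) ≡ x
            l₂ = solve-∀
    id₂ : ∀ a q X → a * (q * X) ≡ X * (q * a)
    id₂ = solve-∀

  private
    e g : ℤ → ℤ
    e = solution quiddityRow 0ℤ 1ℤ
    g = solution quiddityRow 1ℤ 0ℤ

    from-sum : ∀ x y z → x + y ≡ z → z - y ≡ x
    from-sum x y z refl = l x y
      where l : ∀ x y → x + y - y ≡ x
            l = solve-∀

    first : ∀ k → e (+ k) ≡ entry 1ℤ (+ k - 1ℤ) × e (+ suc k) ≡ entry 1ℤ (+ k)
    first zero    = sym (zeros 1ℤ) , sym (ones 1ℤ)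
    first (suc k) = proj₂ (first k) ,
      trans (cong₂ (λ x y → quiddityRow (+ suc k) * x - y) (proj₂ (first k)) (trans (proj₁ (first k)) (cong (entry 1ℤ) (l (+ k)))))
        (from-sum (entry 1ℤ (+ suc k)) (entry 1ℤ (+ suc k - + 2)) _ (row-recurrence k 1ℤ (+ suc k) refl))
      where l : ∀ k → k - 1ℤ ≡ (1ℤ + k) - + 2
            l = solve-∀

    second : ∀ k → g (+ suc k) ≡ - entry (+ 2) (+ k) × g (+ suc (suc k)) ≡ - entry (+ 2) (+ suc k)
    second zero    = cong -_ (sym (zeros (+ 2))) ,
      trans (l (quiddityRow 1ℤ)) (cong -_ (sym (ones (+ 2))))
      where l : ∀ x → x * 0ℤ - 1ℤ ≡ - 1ℤ
            l = solve-∀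
    second (suc k) = proj₂ (second k) ,
      trans (cong₂ (λ x y → quiddityRow (+ suc (suc k)) * x - y) (proj₂ (second k)) (proj₁ (second k)))
        (trans (l (quiddityRow (+ suc (suc k))) (entry (+ 2) (+ suc k)) (entry (+ 2) (+ k)))
          (cong -_ (from-sum (entry (+ 2) (+ suc (suc k))) (entry (+ 2) (+ k)) _ (row-recurrence k (+ 2) (+ suc (suc k)) refl))))
      where l : ∀ q x y → q * (- x) - (- y) ≡ - (q * x - y)
            l = solve-∀

  -- Row 1 is `e` and row 2 is minus `g`, each with its index moved by one; the minus sign in `s` is
  -- the sign of `g`.
  s-as-trace : ∀ n → s (suc n) F ≡ e (1ℤ + + suc n) + g (0ℤ + + suc n)
  s-as-trace n = sym (cong₂ _+_ (proj₂ (first (suc n))) (proj₁ (second n)))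

-- Lifting a triangulation to the strip

opposite : Side → Side
opposite outer = inner
opposite inner = outer

bridgeFrom : Side → ℤ → ℤ → StripCurve
bridgeFrom outer x y = bridge x y
bridgeFrom inner x y = bridge y x

StripCrosses-sym : ∀ s s′ → StripCrosses s s′ → StripCrosses s′ s
StripCrosses-sym (chord outer _ _) (chord outer _ _) c = Sum.swap c
StripCrosses-sym (chord inner _ _) (chord inner _ _) c = Sum.swap c
StripCrosses-sym (chord outer _ _) (bridge _ _)      c = c
StripCrosses-sym (chord inner _ _) (bridge _ _)      c = c
StripCrosses-sym (bridge _ _)      (chord outer _ _) c = c
StripCrosses-sym (bridge _ _)      (chord inner _ _) c = c
StripCrosses-sym (bridge _ _)      (bridge _ _)      c = Sum.swap c

x+[t+u]N : ∀ x t u N → x + t * N + u * N ≡ x + (t + u) * N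
x+[t+u]N = solve-∀

-- Rules out contractible chords and boundary segments. By `base-valid` and `represent` this leaves,
-- for nonzero n and m, exactly the lifts of curves.
Valid : StripCurve → Set
Valid (chord _ a b) = sucℤ a < b
Valid (bridge _ _)  = ⊤

windows-disjoint : ∀ {N} (v v′ : Fin N) {t t′} → t < t′ →
  label v + t * + N < label v′ + t′ * + N
windows-disjoint {N} v v′ {t} {t′} t<t′ = begin-strict
  label v + t * + N    ≤⟨ ℤ.+-monoˡ-≤ (t * + N) (ℤ.+≤+ (toℕ<n v)) ⟩
  + N + t * + N        ≡⟨ ℤ.suc-* t (+ N) ⟨
  sucℤ t * + N         ≤⟨ ℤ.*-monoʳ-≤-nonNeg (+ N) (ℤ.i<j⇒suc[i]≤j t<t′) ⟩
  t′ * + N             ≡⟨ ℤ.+-identityˡ (t′ * + N) ⟨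
  0ℤ + t′ * + N        <⟨ ℤ.+-monoˡ-< (t′ * + N) (ℤ.+<+ ℕ.z<s) ⟩
  label v′ + t′ * + N  ∎
  where open ℤ.≤-Reasoning

label-injective : ∀ {N} (v v′ : Fin N) t t′ →
  label v + t * + N ≡ label v′ + t′ * + N → v ≡ v′ × t ≡ t′
label-injective {N} v v′ t t′ eq with ℤ.<-cmp t t′
... | tri< t<t′ _ _ = ⊥-elim (ℤ.<-irrefl eq (windows-disjoint v v′ t<t′))
... | tri> _ _ t′<t = ⊥-elim (ℤ.<-irrefl (sym eq) (windows-disjoint v′ v t′<t))
... | tri≈ _ refl _ =
  toℕ-injective (ℕ.suc-injective (ℤ.+-injective (+-cancelʳ (t * + N) (label v) (label v′) eq))) , refl

module Cover (n m : ℕ) where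

  private
    N : Side → ℕ
    N = size n m

  shift : ℤ → StripCurve → StripCurve
  shift u (chord σ a b) = chord σ (a + u * + N σ) (b + u * + N σ)
  shift u (bridge a b)  = bridge (a + u * + n) (b + u * + m)

  shift-shift : ∀ t u s → shift u (shift t s) ≡ shift (t + u) s
  shift-shift t u (chord σ a b) = cong₂ (chord σ) (x+[t+u]N a t u (+ N σ)) (x+[t+u]N b t u (+ N σ))
  shift-shift t u (bridge a b)  = cong₂ bridge (x+[t+u]N a t u (+ n)) (x+[t+u]N b t u (+ m))

  shift-0 : ∀ s → shift 0ℤ s ≡ s
  shift-0 (chord σ a b) = cong₂ (chord σ) (ℤ.+-identityʳ a) (ℤ.+-identityʳ b)
  shift-0 (bridge a b)  = cong₂ bridge (ℤ.+-identityʳ a) (ℤ.+-identityʳ b)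

  shift-StripCrosses : ∀ u s s′ → StripCrosses s s′ → StripCrosses (shift u s) (shift u s′)
  shift-StripCrosses u = go
    where
    mono : ∀ k {a c} → a < c → a + u * + k < c + u * + k
    mono k = ℤ.+-monoˡ-< (u * + k)
    interlaced : ∀ k {a b c d} → Interlaced a b c d →
      Interlaced (a + u * + k) (b + u * + k) (c + u * + k) (d + u * + k)
    interlaced k (inj₁ (h , h′ , h″)) = inj₁ (mono k h , mono k h′ , mono k h″)
    interlaced k (inj₂ (h , h′ , h″)) = inj₂ (mono k h , mono k h′ , mono k h″)
    go : ∀ s s′ → StripCrosses s s′ → StripCrosses (shift u s) (shift u s′)
    go (chord outer _ _) (chord outer _ _) c = interlaced n c
    go (chord inner _ _) (chord inner _ _) c = interlaced m c
    go (chord outer _ _) (bridge _ _) (h , h′) = mono n h , mono n h′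
    go (chord inner _ _) (bridge _ _) (h , h′) = mono m h , mono m h′
    go (bridge _ _) (chord outer _ _) (h , h′) = mono n h , mono n h′
    go (bridge _ _) (chord inner _ _) (h , h′) = mono m h , mono m h′
    go (bridge _ _) (bridge _ _) (inj₁ (h , h′)) = inj₁ (mono n h , mono m h′)
    go (bridge _ _) (bridge _ _) (inj₂ (h , h′)) = inj₂ (mono n h , mono m h′)

  base : Curve n m → StripCurve
  base (peripheral σ v k _) = chord σ (label v) (label v + + k)
  base (bridging v j)       = bridge (label v) j

  lift≡shift : ∀ t γ → lift n m t γ ≡ shift t (base γ)
  lift≡shift t (peripheral σ v k _) = refl
  lift≡shift t (bridging v j)       = refl

  -- Labels fill one window of length N, so the first endpoint determines both vertex and translate.
  -- Distinct arcs therefore have no lift in common, which keeps `star` free of repetitions.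
  shift-base-injective : ∀ t t′ γ γ′ → shift t (base γ) ≡ shift t′ (base γ′) → γ ≡ γ′
  shift-base-injective t t′ (peripheral σ v k _) (peripheral σ′ v′ k′ _) eq with chord-σ eq
    where
    chord-σ : ∀ {σ a b σ′ a′ b′} → chord σ a b ≡ chord σ′ a′ b′ → σ ≡ σ′
    chord-σ refl = refl
  ... | refl with label-injective v v′ t t′ (chord-a eq)
    where
    chord-a : ∀ {σ a b a′ b′} → chord σ a b ≡ chord σ a′ b′ → a ≡ a′
    chord-a refl = refl
  ... | refl , refl with ℤ.+-injective (+-cancelˡ (label v) (+ k) (+ k′)
                          (+-cancelʳ (t * + N σ) (label v + + k) (label v + + k′) (chord-b eq)))
    where
    chord-b : ∀ {σ a b a′ b′} → chord σ a b ≡ chord σ a′ b′ → b ≡ b′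
    chord-b refl = refl
  ... | refl = refl
  shift-base-injective t t′ (bridging v j) (bridging v′ j′) eq
    with label-injective v v′ t t′ (cong (λ { (bridge a _) → a ; _ → 0ℤ }) eq)
  ... | refl , refl = cong (bridging v) (+-cancelʳ (t * + m) j j′ (cong (λ { (bridge _ b) → b ; _ → 0ℤ }) eq))

  module _ ⦃ n≢0 : ℕ.NonZero n ⦄ ⦃ m≢0 : ℕ.NonZero m ⦄ where

    size≢0 : ∀ σ → ℕ.NonZero (N σ)
    size≢0 outer = n≢0
    size≢0 inner = m≢0

    reduce : ∀ σ x → ∃₂ λ (v : Fin (N σ)) t → x ≡ label v + t * + N σ
    -- Labels start at 1, so it is `pred x` that is divided by N.
    reduce σ x = fromℕ< r<N , q , (begin
      x                               ≡⟨ ℤ.suc-pred x ⟨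
      1ℤ + pred x                     ≡⟨ cong sucℤ (ℤ.a≡a%ℕn+[a/ℕn]*n (pred x) (N σ)) ⟩
      1ℤ + (+ r + q * + N σ)          ≡⟨ ℤ.+-assoc 1ℤ (+ r) (q * + N σ) ⟨
      + suc r + q * + N σ             ≡⟨ cong (λ i → + suc i + q * + N σ) (toℕ-fromℕ< r<N) ⟨
      label (fromℕ< r<N) + q * + N σ  ∎)
      where
      open ≡-Reasoning
      instance _ = size≢0 σ
      r = pred x ℤ.%ℕ N σ
      q = pred x ℤ./ℕ N σ
      r<N = ℤ.n%ℕd<d (pred x) (N σ)

    represent : ∀ s → Valid s → ∃₂ λ γ t → s ≡ shift t (base γ)
    represent (chord σ a b) a+1<b with reduce σ a
    ... | v , t , refl = peripheral σ v ∣b-a∣ 2≤ , t ,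
        cong (chord σ _) (trans (id (label v) b (t * + N σ)) (cong (λ z → label v + z + t * + N σ) (sym b-a≡)))
      where
      a′ = label v + t * + N σ
      ∣b-a∣ = ℤ.∣ b - a′ ∣
      2≤b-a : + 2 ℤ.≤ b - a′
      2≤b-a = ℤ.≤-trans (ℤ.≤-reflexive (id′ a′)) (ℤ.+-monoˡ-≤ (- a′) (ℤ.i<j⇒suc[i]≤j a+1<b))
        where id′ : ∀ x → + 2 ≡ 1ℤ + (1ℤ + x) - x
              id′ = solve-∀
      b-a≡ : + ∣b-a∣ ≡ b - a′
      b-a≡ = ℤ.0≤i⇒+∣i∣≡i (ℤ.≤-trans (ℤ.+≤+ ℕ.z≤n) 2≤b-a)
      2≤ : 2 ℕ.≤ ∣b-a∣
      2≤ = ℤ.drop‿+≤+ (ℤ.≤-trans 2≤b-a (ℤ.≤-reflexive (sym b-a≡)))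
      id : ∀ l b z → b ≡ l + (b - (l + z)) + z
      id = solve-∀
    represent (bridge a b) _ with reduce outer a
    ... | v , t , refl = bridging v (b - t * + m) , t , cong (bridge _) (id b (t * + m))
      where id : ∀ x z → x ≡ x - z + z
            id = solve-∀

  base-valid : ∀ t γ → Valid (shift t (base γ))
  base-valid t (peripheral σ v k 2≤k) =
    subst (sucℤ (label v + t * + N σ) <_) (id (+ k) (label v) (t * + N σ))
      (ℤ.+-monoˡ-< (label v + t * + N σ) (ℤ.+<+ (recompute (2 ℕ.≤? k) 2≤k)))
    where id : ∀ k x z → k + (x + z) ≡ x + k + z
          id = solve-∀
  base-valid t (bridging _ _) = tt

  module Lifted (T : Triangulation n m) where
    open Triangulation T

    _∈T : StripCurve → Set
    s ∈T = ∃ λ γ → γ ∈ arcs × ∃ λ t → s ≡ shift t (base γ)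

    ∈T-shift : ∀ u {s} → s ∈T → shift u s ∈T
    ∈T-shift u (γ , γ∈ , t , refl) = γ , γ∈ , t + u , shift-shift t u (base γ)

    ∈T-valid : ∀ {s} → s ∈T → Valid s
    ∈T-valid (γ , _ , t , refl) = base-valid t γ

    ∈T-nonCrossing : ∀ {s s′} → s ∈T → s′ ∈T → ¬ StripCrosses s s′
    ∈T-nonCrossing (γ , γ∈ , t , refl) (δ , δ∈ , u , refl) c =
      nonCrossing γ δ γ∈ δ∈ (t , u , subst₂ StripCrosses (sym (lift≡shift t γ)) (sym (lift≡shift u δ)) c)

    -- Maximality is applied to the arcs together with the curve γ below s. A crossing may involve
    -- any lift of γ; `realign` translates it until that lift is s itself.
    ∈T-maximal : ⦃ _ : ℕ.NonZero n ⦄ ⦃ _ : ℕ.NonZero m ⦄ → ∀ s → Valid s →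
      (∀ s′ → s′ ∈T → ¬ StripCrosses s s′) → (∀ u → ¬ StripCrosses s (shift u s)) → s ∈T
    ∈T-maximal s valid noT noSelf with represent s valid
    ... | γ , t , refl = γ , maximal C C-nonCrossing inj₁ (inj₂ refl) , t , refl
      where
      C : Curve n m → Set
      C δ = δ ∈ arcs ⊎ δ ≡ γ
      realign : ∀ t′ u δ → StripCrosses (lift n m t′ γ) (lift n m u δ) →
        StripCrosses (shift t (base γ)) (shift (u + (t - t′)) (base δ))
      realign t′ u δ c = subst₂ StripCrosses
        (trans (shift-shift t′ (t - t′) (base γ)) (cong (λ z → shift z (base γ)) (id t′ t)))
        (shift-shift u (t - t′) (base δ))
        (shift-StripCrosses (t - t′) _ _ (subst₂ StripCrosses (lift≡shift t′ γ) (lift≡shift u δ) c))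
        where id : ∀ x y → x + (y - x) ≡ y
              id = solve-∀
      no-arc : ∀ {δ} → δ ∈ arcs → ¬ Crosses n m γ δ
      no-arc {δ} δ∈ (t′ , u , c) = noT _ (δ , δ∈ , u + (t - t′) , refl) (realign t′ u δ c)
      C-nonCrossing : NonCrossing n m C
      C-nonCrossing δ δ′ (inj₁ δ∈) (inj₁ δ′∈) c = nonCrossing δ δ′ δ∈ δ′∈ c
      C-nonCrossing δ _ (inj₁ δ∈) (inj₂ refl) (t′ , u , c) = no-arc δ∈ (u , t′ , StripCrosses-sym _ _ c)
      C-nonCrossing _ δ (inj₂ refl) (inj₁ δ∈) c = no-arc δ∈ c
      C-nonCrossing _ _ (inj₂ refl) (inj₂ refl) (t′ , u , c) =
        noSelf (u + (t - t′) - t) (subst (StripCrosses _) (trans (cong (λ z → shift z (base γ)) (id (u + (t - t′)) t)) (sym (shift-shift t _ (base γ)))) (realign t′ u γ c))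
        where id : ∀ x y → x ≡ y + (x - y)
              id = solve-∀

-- The other end of an arc, seen from one of its ends: an earlier or a later
-- point of the same line, or a point of the opposite line.
data Direction : Set where
  left across right : ℤ → Direction

curveAt : Side → ℤ → Direction → StripCurve
curveAt σ x (left p)   = chord σ p x
curveAt σ x (across y) = bridgeFrom σ x y
curveAt σ x (right p)  = chord σ x p

-- Counting arc ends by weights

indicator : ∀ {P : Set} → Dec P → ℕ
indicator p? = if does p? then 1 else 0

indicator-yes : ∀ {P : Set} (p? : Dec P) → P → indicator p? ≡ 1
indicator-yes (yes _) p = refl
indicator-yes (no ¬p) p = ⊥-elim (¬p p)

indicator-no : ∀ {P : Set} (p? : Dec P) → ¬ P → indicator p? ≡ 0
indicator-no (yes p) ¬p = ⊥-elim (¬p p)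
indicator-no (no _)  ¬p = refl

indicator-cong : ∀ {P Q : Set} (p? : Dec P) (q? : Dec Q) → (P → Q) → (Q → P) → indicator p? ≡ indicator q?
indicator-cong (yes p) q? f g = sym (indicator-yes q? (f p))
indicator-cong (no ¬p) q? f g = sym (indicator-no q? λ q → ¬p (g q))

total : ∀ {A : Set} → (A → ℕ) → List A → ℕ
total w xs = sum (map w xs)

module _ {A : Set} where

  total-cong : ∀ {u w : A → ℕ} xs → (∀ {x} → x ∈ xs → w x ≡ u x) → total w xs ≡ total u xs
  total-cong []       h = refl
  total-cong (x ∷ xs) h = cong₂ ℕ._+_ (h (here refl)) (total-cong xs λ x∈ → h (there x∈))

  total-0 : ∀ {w : A → ℕ} xs → (∀ {x} → x ∈ xs → w x ≡ 0) → total w xs ≡ 0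
  total-0 []       h = refl
  total-0 (x ∷ xs) h = cong₂ ℕ._+_ (h (here refl)) (total-0 xs λ x∈ → h (there x∈))

  total-complement : ∀ {u v : A → ℕ} xs → (∀ {x} → x ∈ xs → u x ℕ.+ v x ≡ 1) →
    length xs ≡ total u xs ℕ.+ total v xs
  total-complement []       h = refl
  total-complement {u} {v} (x ∷ xs) h = begin
    suc (length xs)                                     ≡⟨ cong suc (total-complement xs λ x∈ → h (there x∈)) ⟩
    1 ℕ.+ (total u xs ℕ.+ total v xs)                   ≡⟨ cong (ℕ._+ (total u xs ℕ.+ total v xs)) (h (here refl)) ⟨
    (u x ℕ.+ v x) ℕ.+ (total u xs ℕ.+ total v xs)       ≡⟨ interchange (u x) (v x) (total u xs) (total v xs) ⟩
    (u x ℕ.+ total u xs) ℕ.+ (v x ℕ.+ total v xs)       ∎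
    where open ≡-Reasoning

  -- Serves to compare two sets of arc ends at a vertex that differ in a single end x₀; without
  -- repetitions x₀ is counted once.
  total-insert : ∀ {u w : A → ℕ} {x₀ xs} → Unique xs → x₀ ∈ xs →
    (∀ {x} → x ∈ xs → x ≢ x₀ → w x ≡ u x) → w x₀ ≡ suc (u x₀) → total w xs ≡ suc (total u xs)
  total-insert (x₀∉ ∷ _) (here refl) h h₀ =
    cong₂ ℕ._+_ h₀ (total-cong _ λ x∈ → h (there x∈) λ { refl → All.lookup x₀∉ x∈ refl })
  total-insert {u} {w} (x∉ ∷ uniq) (there {x} x₀∈) h h₀ =
    trans (cong₂ ℕ._+_ (h (here refl) (All.lookup x∉ x₀∈)) (total-insert uniq x₀∈ (λ x∈ → h (there x∈)) h₀))
      (ℕ.+-suc (u x) _)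

-- Around a vertex the left chords come first, then the bridges ordered by landing point, then the
-- right chords. `before y` and `notBefore y` cut this order at the bridge to y and leave that
-- bridge in the second half.
rightUpTo leftFrom before notBefore : ℤ → Direction → ℕ
rightUpTo b (right p) = indicator (p ℤ.≤? b)
rightUpTo b _         = 0
leftFrom a (left p)   = indicator (a ℤ.≤? p)
leftFrom a _          = 0
before y (left _)     = 1
before y (across j)   = indicator (j ℤ.<? y)
before y (right _)    = 0
notBefore y (left _)   = 0
notBefore y (across j) = indicator (y ℤ.≤? j)
notBefore y (right _)  = 1

-- The default x₀ will be the next marked point, so that the result is always the far end of a
-- triangle side: a boundary segment if no chord qualifies.
furthestRight : ∀ {Q : ℤ → Set} → (∀ p → Dec (Q p)) → ∀ x₀ (ds : List Direction) →
  ∃ λ x → x₀ ℤ.≤ x × (x ≡ x₀ ⊎ right x ∈ ds × Q x) × (∀ p → right p ∈ ds → Q p → p ℤ.≤ x)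
furthestRight Q? x₀ [] = x₀ , ℤ.≤-refl , inj₁ refl , λ _ ()
furthestRight Q? x₀ (d ∷ ds) with furthestRight Q? x₀ ds
furthestRight Q? x₀ (left _ ∷ ds) | x , x₀≤x , where-x , max =
  x , x₀≤x , Sum.map₂ (λ (x∈ , Qx) → there x∈ , Qx) where-x , λ { p (there p∈) Qp → max p p∈ Qp }
furthestRight Q? x₀ (across _ ∷ ds) | x , x₀≤x , where-x , max =
  x , x₀≤x , Sum.map₂ (λ (x∈ , Qx) → there x∈ , Qx) where-x , λ { p (there p∈) Qp → max p p∈ Qp }
furthestRight Q? x₀ (right r ∷ ds) | x , x₀≤x , where-x , max with Q? r | x ℤ.≤? r
... | yes Qr | yes x≤r = r , ℤ.≤-trans x₀≤x x≤r , inj₂ (here refl , Qr) ,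
  λ { p (here refl) Qp → ℤ.≤-refl ; p (there p∈) Qp → ℤ.≤-trans (max p p∈ Qp) x≤r }
... | yes Qr | no x≰r = x , x₀≤x , Sum.map₂ (λ (x∈ , Qx) → there x∈ , Qx) where-x ,
  λ { p (here refl) Qp → ℤ.<⇒≤ (ℤ.≰⇒> x≰r) ; p (there p∈) Qp → max p p∈ Qp }
... | no ¬Qr | _ = x , x₀≤x , Sum.map₂ (λ (x∈ , Qx) → there x∈ , Qx) where-x ,
  λ { p (here refl) Qp → ⊥-elim (¬Qr Qp) ; p (there p∈) Qp → max p p∈ Qp }

x<sucx : ∀ x → x < sucℤ x
x<sucx x = ℤ.suc[i]≤j⇒i<j ℤ.≤-refl

no-between : ∀ {x p} → x < p → p < sucℤ x → ⊥
no-between x<p p<sx = ℤ.<-irrefl refl (ℤ.<-≤-trans p<sx (ℤ.i<j⇒suc[i]≤j x<p))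

y-x+x≡y : ∀ x y → y - x + x ≡ y
y-x+x≡y = solve-∀

y-x+[x+z]≡y+z : ∀ x y z → y - x + (x + z) ≡ y + z
y-x+[x+z]≡y+z = solve-∀

<+-transfer : ∀ {x z} y → x < x + z → y < y + z
<+-transfer {x} {z} y h = subst₂ _<_ (y-x+x≡y x y) (y-x+[x+z]≡y+z x y z) (ℤ.+-monoʳ-< (y - x) h)

+<-transfer : ∀ {x z} y → x + z < x → y + z < y
+<-transfer {x} {z} y h = subst₂ _<_ (y-x+[x+z]≡y+z x y z) (y-x+x≡y x y) (ℤ.+-monoʳ-< (y - x) h)

-- A deck transformation moves both lines in the same direction, so a bridge never crosses its own
-- translates.
advance-together : ∀ {n m} ⦃ _ : ℕ.NonZero n ⦄ {x} y u → x < x + u * + n → y ℤ.≤ y + u * + m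
advance-together {n} {m} {x} y u h = subst (ℤ._≤ y + u * + m) (ℤ.+-identityʳ y)
  (ℤ.+-monoʳ-≤ y (ℤ.*-monoʳ-≤-nonNeg (+ m) {0ℤ} {u} (ℤ.<⇒≤ 0<u)))
  where
  0<un : 0ℤ < u * + n
  0<un = subst (0ℤ <_) (ℤ.+-identityˡ (u * + n)) (<+-transfer {x} 0ℤ h)
  0<u : 0ℤ < u
  0<u = ℤ.*-cancelʳ-<-nonNeg {0ℤ} {u} (+ n) 0<un

module _ {n m : ℕ} ⦃ n≢0 : ℕ.NonZero n ⦄ ⦃ m≢0 : ℕ.NonZero m ⦄ (T : Triangulation n m) where
  open Triangulation T
  open Cover n m
  open Lifted T

  private
    N : Side → ℕ
    N = size n m

  -- Ends of arcs at a lifted vertex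

  shiftDirection : Side → ℤ → Direction → Direction
  shiftDirection σ t (left p)   = left (p + t * + N σ)
  shiftDirection σ t (across y) = across (y + t * + N (opposite σ))
  shiftDirection σ t (right p)  = right (p + t * + N σ)

  shift-curveAt : ∀ σ t x d →
    shift t (curveAt σ x d) ≡ curveAt σ (x + t * + N σ) (shiftDirection σ t d)
  shift-curveAt σ     t x (left p)   = refl
  shift-curveAt outer t x (across y) = refl
  shift-curveAt inner t x (across y) = refl
  shift-curveAt σ     t x (right p)  = refl

  shiftDirection-+ : ∀ σ t u d → shiftDirection σ u (shiftDirection σ t d) ≡ shiftDirection σ (t + u) d
  shiftDirection-+ σ t u (left p)   = cong left (x+[t+u]N p t u (+ N σ))
  shiftDirection-+ σ t u (across y) = cong across (x+[t+u]N y t u (+ N (opposite σ)))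
  shiftDirection-+ σ t u (right p)  = cong right (x+[t+u]N p t u (+ N σ))

  directedEnds : Side → Curve n m → List (ℤ × Direction)
  directedEnds outer (peripheral outer v k _) = (label v , right (label v + + k)) ∷ (label v + + k , left (label v)) ∷ []
  directedEnds inner (peripheral inner v k _) = (label v , right (label v + + k)) ∷ (label v + + k , left (label v)) ∷ []
  directedEnds outer (peripheral inner _ _ _) = []
  directedEnds inner (peripheral outer _ _ _) = []
  directedEnds outer (bridging v j)           = (label v , across j) ∷ []
  directedEnds inner (bridging v j)           = (j , across (label v)) ∷ []

  ends≡ : ∀ σ γ → ends σ γ ≡ map proj₁ (directedEnds σ γ)
  ends≡ outer (peripheral outer v k _) = refl
  ends≡ inner (peripheral inner v k _) = refl
  ends≡ outer (peripheral inner _ _ _) = refl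
  ends≡ inner (peripheral outer _ _ _) = refl
  ends≡ outer (bridging v j)           = refl
  ends≡ inner (bridging v j)           = refl

  directedEnds-sound : ∀ σ γ {e d} → (e , d) ∈ directedEnds σ γ → curveAt σ e d ≡ base γ
  directedEnds-sound outer (peripheral outer v k _) (here refl) = refl
  directedEnds-sound outer (peripheral outer v k _) (there (here refl)) = refl
  directedEnds-sound inner (peripheral inner v k _) (here refl) = refl
  directedEnds-sound inner (peripheral inner v k _) (there (here refl)) = refl
  directedEnds-sound outer (bridging v j) (here refl) = refl
  directedEnds-sound inner (bridging v j) (here refl) = refl

  directedEnds-complete : ∀ σ γ t x d → curveAt σ x d ≡ shift t (base γ) →
    ∃₂ λ e d₀ → (e , d₀) ∈ directedEnds σ γ × x ≡ e + t * + N σ × d ≡ shiftDirection σ t d₀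
  directedEnds-complete outer (peripheral outer v k _) t x (left p)   refl = _ , _ , there (here refl) , refl , refl
  directedEnds-complete outer (peripheral outer v k _) t x (right p)  refl = _ , _ , here refl , refl , refl
  directedEnds-complete inner (peripheral inner v k _) t x (left p)   refl = _ , _ , there (here refl) , refl , refl
  directedEnds-complete inner (peripheral inner v k _) t x (right p)  refl = _ , _ , here refl , refl , refl
  directedEnds-complete outer (bridging v j)           t x (across y) refl = _ , _ , here refl , refl , refl
  directedEnds-complete inner (bridging v j)           t x (across y) refl = _ , _ , here refl , refl , refl

  directedArcEnds : Side → List (ℤ × Direction)
  directedArcEnds σ = concatMap (directedEnds σ) arcs

  -- An arc end over the same vertex as x has exactly one translate at x; the result is its
  -- direction there.
  occurrence : Side → ℤ → ℤ × Direction → List Direction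
  occurrence σ x (e , d) with + N σ ∣? x - e
  ... | yes (divides t _) = shiftDirection σ t d ∷ []
  ... | no _              = []

  -- A loop ending at x contributes two directions.
  star : Side → ℤ → List Direction
  star σ x = concatMap (occurrence σ x) (directedArcEnds σ)

  private
    x-e≡ : ∀ {x e z} → x - e ≡ z → x ≡ e + z
    x-e≡ {x} {e} refl = l x e
      where l : ∀ x e → x ≡ e + (x - e)
            l = solve-∀
    ≡e+ : ∀ {x e z} → x ≡ e + z → x - e ≡ z
    ≡e+ {_} {e} {z} refl = l e z
      where l : ∀ e z → e + z - e ≡ z
            l = solve-∀

  occurrence⁻ : ∀ σ x e d {d′} → d′ ∈ occurrence σ x (e , d) →
    ∃ λ t → x ≡ e + t * + N σ × d′ ≡ shiftDirection σ t d
  occurrence⁻ σ x e d d′∈ with + N σ ∣? x - e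
  occurrence⁻ σ x e d (here refl) | yes (divides t eq) = t , x-e≡ eq , refl

  occurrence-at : ∀ σ t e d → occurrence σ (e + t * + N σ) (e , d) ≡ shiftDirection σ t d ∷ []
  occurrence-at σ t e d with + N σ ∣? (e + t * + N σ) - e
  ... | no ∤ = ⊥-elim (∤ (divides t (≡e+ {e = e} refl)))
  ... | yes (divides u eq) = cong (λ z → shiftDirection σ z d ∷ [])
      (ℤ.*-cancelʳ-≡ u t (+ N σ) {{size≢0 σ}} (trans (sym eq) (≡e+ {e = e} refl)))

  ∈star⇒∈T : ∀ {σ x d} → d ∈ star σ x → curveAt σ x d ∈T
  ∈star⇒∈T {σ} {x} d∈ with find (∈-concatMap⁻ (occurrence σ x) {xs = directedArcEnds σ} d∈)
  ... | (e , d₀) , ed∈ , d∈occ with find (∈-concatMap⁻ (directedEnds σ) {xs = arcs} ed∈) | occurrence⁻ σ x e d₀ d∈occ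
  ...   | γ , γ∈ , ed∈γ | t , refl , refl =
        γ , γ∈ , t , trans (sym (shift-curveAt σ t e d₀)) (cong (shift t) (directedEnds-sound σ γ ed∈γ))

  ∈T⇒∈star : ∀ {σ x d} → curveAt σ x d ∈T → d ∈ star σ x
  ∈T⇒∈star {σ} {x} {d} (γ , γ∈ , t , eq) with directedEnds-complete σ γ t x d eq
  ... | e , d₀ , ed∈ , refl , refl =
    ∈-concatMap⁺ (occurrence σ x) (lose (∈-concatMap⁺ (directedEnds σ) (lose γ∈ ed∈))
      (subst (d ∈_) (sym (occurrence-at σ t e d₀)) (here refl)))

  private
    Apart : Side → ℤ × Direction → ℤ × Direction → Set
    Apart σ (e , d) (e′ , d′) = ∀ t t′ → e + t * + N σ ≡ e′ + t′ * + N σ →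
      shiftDirection σ t d ≢ shiftDirection σ t′ d′

    apart-within : ∀ σ γ → AllPairs (Apart σ) (directedEnds σ γ)
    apart-within outer (peripheral outer v k _) = ((λ _ _ _ ()) ∷ []) ∷ [] ∷ []
    apart-within inner (peripheral inner v k _) = ((λ _ _ _ ()) ∷ []) ∷ [] ∷ []
    apart-within outer (peripheral inner _ _ _) = []
    apart-within inner (peripheral outer _ _ _) = []
    apart-within outer (bridging v j)           = [] ∷ []
    apart-within inner (bridging v j)           = [] ∷ []

    apart-between : ∀ σ {γ δ} → γ ≢ δ →
      All (λ x → All (Apart σ x) (directedEnds σ δ)) (directedEnds σ γ)
    apart-between σ {γ} {δ} γ≢δ = All.tabulate λ {(e , d)} ed∈ → All.tabulate λ {(e′ , d′)} ed′∈ t t′ eq eq′ →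
      γ≢δ (shift-base-injective t t′ γ δ (begin
        shift t (base γ)                                      ≡⟨ cong (shift t) (directedEnds-sound σ γ ed∈) ⟨
        shift t (curveAt σ e d)                               ≡⟨ shift-curveAt σ t e d ⟩
        curveAt σ (e + t * + N σ) (shiftDirection σ t d)      ≡⟨ cong₂ (curveAt σ) eq eq′ ⟩
        curveAt σ (e′ + t′ * + N σ) (shiftDirection σ t′ d′)  ≡⟨ shift-curveAt σ t′ e′ d′ ⟨
        shift t′ (curveAt σ e′ d′)                            ≡⟨ cong (shift t′) (directedEnds-sound σ δ ed′∈) ⟩
        shift t′ (base δ)                                     ∎))
      where open ≡-Reasoning

    apart : ∀ σ → AllPairs (Apart σ) (directedArcEnds σ)
    apart σ = AllPairs.concat⁺ (All.map⁺ (All.tabulate (λ {γ} _ → apart-within σ γ)))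
      (AllPairs.map⁺ (AllPairs.map (apart-between σ) unique))

  -- The two ends of a peripheral arc differ as `left` and `right`, even for a loop. Equal
  -- directions coming from distinct arcs would give these arcs a common lift.
  star-unique : ∀ σ x → Unique (star σ x)
  star-unique σ x = Unique.concat⁺ (All.map⁺ (All.tabulate λ {ed} _ → occurrence-unique ed))
    (AllPairs.map⁺ (AllPairs.map disjoint (apart σ)))
    where
    occurrence-unique : ∀ ed → Unique (occurrence σ x ed)
    occurrence-unique (e , d) with + N σ ∣? x - e
    ... | yes _ = [] ∷ []
    ... | no _  = []
    disjoint : ∀ {ed ed′} → Apart σ ed ed′ → ∀ {d₁} → ¬ (d₁ ∈ occurrence σ x ed × d₁ ∈ occurrence σ x ed′)
    disjoint {e , d} {e′ , d′} ap (d₁∈ , d₁∈′) with occurrence⁻ σ x e d d₁∈ | occurrence⁻ σ x e′ d′ d₁∈′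
    ... | t , refl , refl | t′ , eq , eq′ = ap t t′ eq eq′

  star-periodic : ∀ σ x → star σ (x + 1ℤ * + N σ) ≡ map (shiftDirection σ 1ℤ) (star σ x)
  star-periodic σ x = trans (List.concatMap-cong periodic (directedArcEnds σ))
      (sym (List.map-concatMap (shiftDirection σ 1ℤ) (occurrence σ x) (directedArcEnds σ)))
    where
    l : ∀ e t N → e + t * N + 1ℤ * N ≡ e + (t + 1ℤ) * N
    l = solve-∀
    l′ : ∀ x e t N → (x + 1ℤ * N) - e ≡ t * N → x ≡ e + (t - 1ℤ) * N
    l′ x e t N eq = trans (l₁ x e N) (trans (cong (λ z → e + (z - 1ℤ * N)) eq) (l₂ e t N))
      where l₁ : ∀ x e N → x ≡ e + ((x + 1ℤ * N) - e - 1ℤ * N)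
            l₁ = solve-∀
            l₂ : ∀ e t N → e + (t * N - 1ℤ * N) ≡ e + (t - 1ℤ) * N
            l₂ = solve-∀
    periodic : ∀ ed → occurrence σ (x + 1ℤ * + N σ) ed ≡ map (shiftDirection σ 1ℤ) (occurrence σ x ed)
    periodic (e , d) with + N σ ∣? x - e
    ... | yes (divides t eq) = begin
      occurrence σ (x + 1ℤ * + N σ) (e , d)          ≡⟨ cong (λ y → occurrence σ (y + 1ℤ * + N σ) (e , d)) (x-e≡ {x} {e} eq) ⟩
      occurrence σ (e + t * + N σ + 1ℤ * + N σ) (e , d) ≡⟨ cong (λ y → occurrence σ y (e , d)) (l e t (+ N σ)) ⟩
      occurrence σ (e + (t + 1ℤ) * + N σ) (e , d)    ≡⟨ occurrence-at σ (t + 1ℤ) e d ⟩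
      shiftDirection σ (t + 1ℤ) d ∷ []               ≡⟨ cong (_∷ []) (shiftDirection-+ σ t 1ℤ d) ⟨
      shiftDirection σ 1ℤ (shiftDirection σ t d) ∷ [] ∎
      where open ≡-Reasoning
    ... | no ∤ with + N σ ∣? (x + 1ℤ * + N σ) - e
    ...   | no _ = refl
    ...   | yes (divides t eq) = ⊥-elim (∤ (divides (t - 1ℤ) (≡e+ (l′ x e t (+ N σ) eq))))

  length-star : ∀ σ v x → x LiesOver v → quiddity T σ v ≡ suc (length (star σ x))
  length-star σ v x (divides q x-v≡) = cong suc (begin
    length (filter (liesOver? v) (concatMap (ends σ) arcs))
      ≡⟨ cong (λ l → length (filter (liesOver? v) l)) (trans (List.concatMap-cong (ends≡ σ) arcs) (sym (List.map-concatMap proj₁ (directedEnds σ) arcs))) ⟩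
    length (filter (liesOver? v) (map proj₁ (directedArcEnds σ)))
      ≡⟨ count (directedArcEnds σ) ⟩
    length (star σ x) ∎)
    where
    open ≡-Reasoning
    l₁ : ∀ x e v → x - e ≡ (x - v) - (e - v)
    l₁ = solve-∀
    l₂ : ∀ x e v → e - v ≡ (x - v) - (x - e)
    l₂ = solve-∀
    l₃ : ∀ q t N → q * N - t * N ≡ (q - t) * N
    l₃ = solve-∀
    count : ∀ l → length (filter (liesOver? v) (map proj₁ l)) ≡ length (concatMap (occurrence σ x) l)
    count []            = refl
    count ((e , d) ∷ l) with + N σ ∣? e - label v | + N σ ∣? x - e
    ... | yes p              | yes _ = trans (cong length (List.filter-accept (liesOver? v) p)) (cong suc (count l))
    ... | no ¬p              | no _  = trans (cong length (List.filter-reject (liesOver? v) ¬p)) (count l)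
    ... | yes (divides t eq) | no ∤  = ⊥-elim (∤ (divides (q - t) (trans (l₁ x e (label v)) (trans (cong₂ _-_ x-v≡ eq) (l₃ q t (+ N σ))))))
    ... | no ∤               | yes (divides t eq) = ⊥-elim (∤ (divides (q - t) (trans (l₂ x e (label v)) (trans (cong₂ _-_ x-v≡ eq) (l₃ q t (+ N σ))))))

  -- Triangles of the lifted triangulation

  -- Boundary segments are never arcs but do occur as sides of triangles, hence `Edge`.
  Chord Bridge Edge : Side → ℤ → ℤ → Set
  Chord σ a b  = chord σ a b ∈T
  Bridge σ x y = bridgeFrom σ x y ∈T
  Edge σ a b   = b ≡ sucℤ a ⊎ Chord σ a b

  flip : ∀ σ {x y} → Bridge σ x y → Bridge (opposite σ) y x
  flip outer b = b
  flip inner b = b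

  edge-< : ∀ {σ a b} → Edge σ a b → a < b
  edge-< {a = a} (inj₁ refl) = x<sucx a
  edge-< {a = a} (inj₂ c)    = ℤ.<-trans (x<sucx a) (∈T-valid c)

  chord-chord : ∀ σ {a b c d} → Chord σ a b → Chord σ c d → a < c → c < b → b < d → ⊥
  chord-chord outer ab cd h h′ h″ = ∈T-nonCrossing ab cd (inj₁ (h , h′ , h″))
  chord-chord inner ab cd h h′ h″ = ∈T-nonCrossing ab cd (inj₁ (h , h′ , h″))

  chord-bridge : ∀ σ {a b x y} → Chord σ a b → Bridge σ x y → a < x → x < b → ⊥
  chord-bridge outer ab xy h h′ = ∈T-nonCrossing ab xy (h , h′)
  chord-bridge inner ab xy h h′ = ∈T-nonCrossing ab xy (h , h′)

  bridge-bridge : ∀ σ {x y x′ y′} → Bridge σ x y → Bridge σ x′ y′ → x < x′ → y′ < y → ⊥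
  bridge-bridge outer xy xy′ h h′ = ∈T-nonCrossing xy xy′ (inj₁ (h , h′))
  bridge-bridge inner xy xy′ h h′ = ∈T-nonCrossing xy xy′ (inj₂ (h′ , h))

  edge-chord : ∀ σ {a b c d} → Edge σ a b → Chord σ c d → a < c → c < b → b < d → ⊥
  edge-chord σ (inj₁ refl) cd h h′ h″ = no-between h h′
  edge-chord σ (inj₂ ab)   cd h h′ h″ = chord-chord σ ab cd h h′ h″

  edge-bridge : ∀ σ {a b x y} → Edge σ a b → Bridge σ x y → a < x → x < b → ⊥
  edge-bridge σ (inj₁ refl) xy h h′ = no-between h h′
  edge-bridge σ (inj₂ ab)   xy h h′ = chord-bridge σ ab xy h h′

  maximal-chord : ∀ σ {a b} → sucℤ a < b →
    (∀ {p q} → Chord σ p q → p < a → a < q → q < b → ⊥) →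
    (∀ {p q} → Chord σ p q → a < p → p < b → b < q → ⊥) →
    (∀ {x y} → Bridge σ x y → a < x → x < b → ⊥) →
    (∀ u → ¬ Interlaced a b (a + u * + N σ) (b + u * + N σ)) → Chord σ a b
  maximal-chord outer {a} {b} long h₁ h₂ h₃ h₄ = ∈T-maximal (chord outer a b) long noT h₄
    where
    noT : ∀ s → s ∈T → ¬ StripCrosses (chord outer a b) s
    noT (chord outer p q) pq (inj₁ (h , h′ , h″)) = h₂ pq h h′ h″
    noT (chord outer p q) pq (inj₂ (h , h′ , h″)) = h₁ pq h h′ h″
    noT (bridge x y) xy (h , h′) = h₃ xy h h′
  maximal-chord inner {a} {b} long h₁ h₂ h₃ h₄ = ∈T-maximal (chord inner a b) long noT h₄
    where
    noT : ∀ s → s ∈T → ¬ StripCrosses (chord inner a b) s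
    noT (chord inner p q) pq (inj₁ (h , h′ , h″)) = h₂ pq h h′ h″
    noT (chord inner p q) pq (inj₂ (h , h′ , h″)) = h₁ pq h h′ h″
    noT (bridge x y) xy (h , h′) = h₃ xy h h′

  maximal-bridge : ∀ σ {x y} →
    (∀ {p q} → Chord σ p q → p < x → x < q → ⊥) →
    (∀ {p q} → Chord (opposite σ) p q → p < y → y < q → ⊥) →
    (∀ {p q} → Bridge σ p q → p < x → y < q → ⊥) →
    (∀ {p q} → Bridge σ p q → x < p → q < y → ⊥) → Bridge σ x y
  maximal-bridge outer {x} {y} h₁ h₂ h₃ h₄ = ∈T-maximal (bridge x y) tt noT noSelf
    where
    noT : ∀ s → s ∈T → ¬ StripCrosses (bridge x y) s
    noT (chord outer p q) pq (h , h′) = h₁ pq h h′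
    noT (chord inner p q) pq (h , h′) = h₂ pq h h′
    noT (bridge p q) pq (inj₁ (h , h′)) = h₄ pq h h′
    noT (bridge p q) pq (inj₂ (h , h′)) = h₃ pq h h′
    noSelf : ∀ u → ¬ StripCrosses (bridge x y) (shift u (bridge x y))
    noSelf u (inj₁ (h , h′)) = ℤ.≤⇒≯ (advance-together {n} {m} y u h) h′
    noSelf u (inj₂ (h , h′)) = ℤ.≤⇒≯ (advance-together {m} {n} x u h′) h
  maximal-bridge inner {x} {y} h₁ h₂ h₃ h₄ =
    maximal-bridge outer h₂ h₁ (λ b h h′ → h₄ b h′ h) (λ b h h′ → h₃ b h′ h)

  -- The triangle below the chord ab: c is the furthest neighbour of a before b. An arc crossing cb
  -- would cross ab or ac, or be a chord from a that ends between c and b; so cb is in T by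
  -- maximality.
  apex : ∀ σ {a b} → Chord σ a b →
    ∃ λ c → Edge σ a c × Edge σ c b × (∀ {p} → Chord σ a p → p < b → p ℤ.≤ c)
  apex σ {a} {b} ab with furthestRight (ℤ._<? b) (sucℤ a) (star σ a)
  ... | c , _ , where-c , max = c , ac , cb , max′
    where
    max′ : ∀ {p} → Chord σ a p → p < b → p ℤ.≤ c
    max′ {p} ap p<b = max p (∈T⇒∈star ap) p<b
    ac : Edge σ a c
    ac = Sum.map₂ (λ (c∈ , _) → ∈star⇒∈T c∈) where-c
    c<b : c < b
    c<b = Sum.[ (λ { refl → ∈T-valid ab }) , proj₂ ] where-c
    a<c = edge-< ac
    cb : Edge σ c b
    cb with b ℤ.≟ sucℤ c
    ... | yes b≡ = inj₁ b≡
    ... | no b≢ = inj₂ (maximal-chord σ (ℤ.≤∧≢⇒< (ℤ.i<j⇒suc[i]≤j c<b) (λ e → b≢ (sym e))) h₁ h₂ h₃ h₄)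
      where
      h₁ : ∀ {p q} → Chord σ p q → p < c → c < q → q < b → ⊥
      h₁ {p} pq p<c c<q q<b with ℤ.<-cmp p a
      ... | tri< p<a _ _  = chord-chord σ pq ab p<a (ℤ.<-trans a<c c<q) q<b
      ... | tri≈ _ refl _ = ℤ.≤⇒≯ (max′ pq q<b) c<q
      ... | tri> _ _ a<p  = edge-chord σ ac pq a<p p<c c<q
      h₂ : ∀ {p q} → Chord σ p q → c < p → p < b → b < q → ⊥
      h₂ pq c<p = chord-chord σ ab pq (ℤ.<-trans a<c c<p)
      h₃ : ∀ {x y} → Bridge σ x y → c < x → x < b → ⊥
      h₃ xy c<x = chord-bridge σ ab xy (ℤ.<-trans a<c c<x)
      ab+ : ∀ u → Chord σ (a + u * + N σ) (b + u * + N σ)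
      ab+ u = ∈T-shift u ab
      -- A translation moves a and c by the same amount, so if cb interlaced with its translate, ab
      -- would too.
      h₄ : ∀ u → ¬ Interlaced c b (c + u * + N σ) (b + u * + N σ)
      h₄ u (inj₁ (h , h′ , h″)) = chord-chord σ ab (ab+ u) (<+-transfer {c} a h)
        (ℤ.<-trans (ℤ.+-monoˡ-< (u * + N σ) a<c) h′) h″
      h₄ u (inj₂ (h , h′ , h″)) = chord-chord σ (ab+ u) ab (+<-transfer {c} a h)
        (ℤ.<-trans a<c h′) h″

  -- The triangle to the right of the bridge from x to y, in the case that its base lies on the line
  -- σ and its apex is y.
  record Step (σ : Side) (x y : ℤ) : Set where
    field
      target   : ℤ
      edge     : Edge σ x target
      landing  : Bridge σ target y
      furthest : ∀ {p} → Chord σ x p → p ℤ.≤ target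

  -- An arc crossing the bridge from x₁ to y would cross the given bridge or the base, or be a chord
  -- from x beyond x₁ or a bridge from x beyond y; the choice of x₁ and `top` exclude the last two.
  advance : ∀ σ {x y} → Bridge σ x y → (∀ {q} → Bridge σ x q → y < q → ⊥) → Step σ x y
  advance σ {x} {y} xy top with furthestRight {λ _ → ⊤} (λ _ → yes tt) (sucℤ x) (star σ x)
  ... | x₁ , _ , where-x₁ , max = record
    { target = x₁ ; edge = xx₁ ; furthest = max′ ; landing = maximal-bridge σ h₁ h₂ h₃ h₄ }
    where
    max′ : ∀ {p} → Chord σ x p → p ℤ.≤ x₁
    max′ {p} xp = max p (∈T⇒∈star xp) tt
    xx₁ : Edge σ x x₁
    xx₁ = Sum.map₂ (λ (x∈ , _) → ∈star⇒∈T x∈) where-x₁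
    x<x₁ = edge-< xx₁
    h₁ : ∀ {p q} → Chord σ p q → p < x₁ → x₁ < q → ⊥
    h₁ {p} pq p<x₁ x₁<q with ℤ.<-cmp p x
    ... | tri< p<x _ _  = chord-bridge σ pq xy p<x (ℤ.<-trans x<x₁ x₁<q)
    ... | tri≈ _ refl _ = ℤ.≤⇒≯ (max′ pq) x₁<q
    ... | tri> _ _ x<p  = edge-chord σ xx₁ pq x<p p<x₁ x₁<q
    h₂ : ∀ {p q} → Chord (opposite σ) p q → p < y → y < q → ⊥
    h₂ pq = chord-bridge (opposite σ) pq (flip σ xy)
    h₃ : ∀ {p q} → Bridge σ p q → p < x₁ → y < q → ⊥
    h₃ {p} pq p<x₁ y<q with ℤ.<-cmp p x
    ... | tri< p<x _ _  = bridge-bridge σ pq xy p<x y<q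
    ... | tri≈ _ refl _ = top pq y<q
    ... | tri> _ _ x<p  = edge-bridge σ xx₁ pq x<p p<x₁
    h₄ : ∀ {p q} → Bridge σ p q → x₁ < p → q < y → ⊥
    h₄ pq x₁<p q<y = bridge-bridge σ xy pq (ℤ.<-trans x<x₁ x₁<p) q<y

  -- Polygons cut off by chords

  -- The number of triangles at a, resp. at b, in the polygon cut off by the
  -- chord from a to b: each triangle at the vertex is counted by the longer of
  -- its two sides there.
  startFan endFan : Side → ℤ → ℤ → ℕ
  startFan σ a b = total (rightUpTo b) (star σ a)
  endFan σ a b   = total (leftFrom a) (star σ b)

  startFan-edge : ∀ σ a → startFan σ a (sucℤ a) ≡ 0
  startFan-edge σ a = total-0 (star σ a) λ
    { {left _} _ → refl
    ; {across _} _ → refl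
    ; {right p} p∈ → indicator-no (p ℤ.≤? sucℤ a) (ℤ.<⇒≱ (∈T-valid (∈star⇒∈T p∈))) }

  endFan-edge : ∀ σ a → endFan σ a (sucℤ a) ≡ 0
  endFan-edge σ a = total-0 (star σ (sucℤ a)) λ
    { {left p} p∈ → indicator-no (a ℤ.≤? p) (λ a≤p → ℤ.<-irrefl refl (ℤ.<-≤-trans (∈T-valid (∈star⇒∈T p∈)) (ℤ.+-monoʳ-≤ 1ℤ a≤p)))
    ; {across _} _ → refl
    ; {right p} _ → refl }

  module _ σ {a b c} (ab : Chord σ a b) (ac : Edge σ a c) (cb : Edge σ c b)
    (max : ∀ {p} → Chord σ a p → p < b → p ℤ.≤ c) where

    private
      a<c = edge-< ac
      c<b = edge-< cb

    -- The triangle abc adds one to the polygon below ac: by the choice of c, no chord from a other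
    -- than ab ends after c and up to b.
    startFan-apex : startFan σ a b ≡ suc (startFan σ a c)
    startFan-apex = total-insert (star-unique σ a) (∈T⇒∈star ab) other
      (trans (indicator-yes (b ℤ.≤? b) ℤ.≤-refl) (cong suc (sym (indicator-no (b ℤ.≤? c) (ℤ.<⇒≱ c<b)))))
      where
      other : ∀ {d} → d ∈ star σ a → d ≢ right b → rightUpTo b d ≡ rightUpTo c d
      other {left _}   _ _ = refl
      other {across _} _ _ = refl
      other {right p} p∈ p≢b = indicator-cong (p ℤ.≤? b) (p ℤ.≤? c)
        (λ p≤b → max (∈star⇒∈T p∈) (ℤ.≤∧≢⇒< p≤b λ { refl → p≢b refl }))
        (λ p≤c → ℤ.≤-trans p≤c (ℤ.<⇒≤ c<b))

    -- Here the other chords to exclude start strictly between a and c; they would cross ac.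
    endFan-apex : endFan σ a b ≡ suc (endFan σ c b)
    endFan-apex = total-insert (star-unique σ b) (∈T⇒∈star ab) other
      (trans (indicator-yes (a ℤ.≤? a) ℤ.≤-refl) (cong suc (sym (indicator-no (c ℤ.≤? a) (ℤ.<⇒≱ a<c)))))
      where
      other : ∀ {d} → d ∈ star σ b → d ≢ left a → leftFrom a d ≡ leftFrom c d
      other {across _} _ _ = refl
      other {right _} _ _ = refl
      other {left p} p∈ p≢a = indicator-cong (a ℤ.≤? p) (c ℤ.≤? p)
        (λ a≤p → ℤ.≮⇒≥ λ p<c → edge-chord σ ac (∈star⇒∈T p∈)
          (ℤ.≤∧≢⇒< a≤p λ { refl → p≢a refl }) p<c c<b)
        (λ c≤p → ℤ.≤-trans (ℤ.<⇒≤ a<c) c≤p)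

    -- A bridge at c, or a chord from c that leaves the polygon, would cross ab.
    degree-apex : length (star σ c) ≡ endFan σ a c ℕ.+ startFan σ c b
    degree-apex = total-complement (star σ c) λ
      { {left p} p∈ → trans (ℕ.+-identityʳ _) (indicator-yes (a ℤ.≤? p) (ℤ.≮⇒≥ λ p<a → chord-chord σ (∈star⇒∈T p∈) ab p<a a<c c<b))
      ; {across j} j∈ → ⊥-elim (chord-bridge σ ab (∈star⇒∈T j∈) a<c c<b)
      ; {right p} p∈ → indicator-yes (p ℤ.≤? b) (ℤ.≮⇒≥ λ b<p → chord-chord σ ab (∈star⇒∈T p∈) a<c c<b b<p) }

  module _ σ {a p : ℤ → ℤ} (deg : ∀ x → a x ≡ + suc (length (star σ x))) (sol : Solution a p) where

    private
      -- The triangles at the apex c are abc itself, R₁ below ac and L₂ below cb. The recurrence at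
      -- c turns this count into pa + pb = pc, and with it the relation for each short side becomes
      -- the one for ab.
      glue : ∀ {pa pb pc} A C₋ C₊ B L₁ R₁ L₂ R₂ {q} → C₊ + C₋ ≡ q * pc → q ≡ 1ℤ + (R₁ + L₂) →
        pc ≡ A - L₁ * pa → pa ≡ C₋ - R₁ * pc → pb ≡ C₊ - L₂ * pc → pc ≡ B - R₂ * pb →
        pb ≡ A - (1ℤ + L₁) * pa × pa ≡ B - (1ℤ + R₂) * pb
      glue {pa} {pb} {pc} A C₋ C₊ B L₁ R₁ L₂ R₂ rec refl h₁ h₂ h₃ h₄ =
        trans (l₁ pa pb) (trans (cong (_- pa) (trans sum′ h₁)) (l₃ A L₁ pa)) ,
        trans (l₂ pa pb) (trans (cong (_- pb) (trans sum′ h₄)) (l₃ B R₂ pb))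
        where
        l₀ : ∀ C₋ C₊ pc R₁ L₂ → C₋ - R₁ * pc + (C₊ - L₂ * pc) ≡ (C₊ + C₋) - (R₁ + L₂) * pc
        l₀ = solve-∀
        l₀′ : ∀ pc x → (1ℤ + x) * pc - x * pc ≡ pc
        l₀′ = solve-∀
        sum′ : pa + pb ≡ pc
        sum′ = trans (cong₂ _+_ h₂ h₃) (trans (l₀ C₋ C₊ pc R₁ L₂) (trans (cong (_- (R₁ + L₂) * pc) rec) (l₀′ pc (R₁ + L₂))))
        l₁ : ∀ pa pb → pb ≡ (pa + pb) - pa
        l₁ = solve-∀
        l₂ : ∀ pa pb → pa ≡ (pa + pb) - pb
        l₂ = solve-∀
        l₃ : ∀ A L x → A - L * x - x ≡ A - (1ℤ + L) * x
        l₃ = solve-∀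

      PolygonRelations : ℤ → ℤ → Set
      PolygonRelations x y = p y ≡ p (sucℤ x) - + startFan σ x y * p x × p x ≡ p (pred y) - + endFan σ x y * p y

      polygon-bounded : ∀ fuel {x y} → Edge σ x y → y ℤ.≤ x + + fuel → PolygonRelations x y
      polygon-bounded fuel {x} (inj₁ refl) _ rewrite startFan-edge σ x | endFan-edge σ x | ℤ.pred-suc x =
        l (p (sucℤ x)) (p x) , l (p x) (p (sucℤ x))
        where l : ∀ u v → u ≡ u - 0ℤ * v
              l = solve-∀
      polygon-bounded zero {x} {y} (inj₂ xy) y≤ =
        ⊥-elim (ℤ.≤⇒≯ (subst (y ℤ.≤_) (ℤ.+-identityʳ x) y≤) (edge-< (inj₂ xy)))
      polygon-bounded (suc fuel) {x} {y} (inj₂ xy) y≤ with apex σ xy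
      ... | c , xc , cy , max rewrite startFan-apex σ xy xc cy max | endFan-apex σ xy xc cy max =
        let l = polygon-bounded fuel xc (ℤ.≤-trans (ℤ.i<j⇒i≤pred[j] (edge-< cy)) (ℤ.≤-trans (ℤ.+-monoʳ-≤ -1ℤ y≤) (ℤ.≤-reflexive (e x (+ fuel)))))
            r = polygon-bounded fuel cy (ℤ.≤-trans y≤ (ℤ.≤-trans (ℤ.≤-reflexive (e′ x (+ fuel))) (ℤ.+-monoˡ-≤ (+ fuel) (ℤ.i<j⇒suc[i]≤j (edge-< xc)))))
        in glue (p (sucℤ x)) (p (pred c)) (p (sucℤ c)) (p (pred y)) (+ startFan σ x c) (+ endFan σ x c) (+ startFan σ c y) (+ endFan σ c y)
             (recurrence sol c) (trans (deg c) (cong (λ k → + suc k) (degree-apex σ xy xc cy max)))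
             (proj₁ l) (proj₂ l) (proj₁ r) (proj₂ r)
        where e : ∀ x f → -1ℤ + (x + (1ℤ + f)) ≡ x + f
              e = solve-∀
              e′ : ∀ x f → x + (1ℤ + f) ≡ 1ℤ + x + f
              e′ = solve-∀

    polygon : ∀ {x y} → Edge σ x y → PolygonRelations x y
    polygon {x} {y} xy = polygon-bounded ℤ.∣ y - x ∣ xy (ℤ.≤-reflexive
      (trans (l x y) (cong (_+_ x) (sym (ℤ.0≤i⇒+∣i∣≡i (ℤ.i≤j⇒0≤j-i (ℤ.<⇒≤ (edge-< xy))))))))
      where l : ∀ x y → y ≡ x + (y - x)
            l = solve-∀

  -- Effect of a step on the extension across

  -- The value at y of the extension of p to the opposite line; one plus the
  -- number of ends before y counts the triangles at x to the left of the bridge.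
  across-value : Side → (ℤ → ℤ) → ℤ → ℤ → ℤ
  across-value σ p x y = + suc (total (before y) (star σ x)) * p x - p (pred x)

  module _ σ {x y} (xy : Bridge σ x y) (step : Step σ x y) where
    open Step step renaming (target to x₁)
    private x<x₁ = edge-< edge

    -- The ends at x₁ before y are left chords only, since an earlier bridge would cross the one
    -- from x to y; a left chord reaching beyond x would cross it as well.
    before-target : total (before y) (star σ x₁) ≡ endFan σ x x₁
    before-target = total-cong (star σ x₁) λ
      { {left p} p∈ → sym (indicator-yes (x ℤ.≤? p) (ℤ.≮⇒≥ λ p<x → chord-bridge σ (∈star⇒∈T p∈) xy p<x x<x₁))
      ; {across j} j∈ → indicator-no (j ℤ.<? y) (λ j<y → bridge-bridge σ xy (∈star⇒∈T j∈) x<x₁ j<y)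
      ; {right _} _ → refl }

    -- A bridge from x beyond y would cross the landing bridge, and all right chords end by x₁.
    -- Apart from the bridge itself only the fan below the base remains.
    notBefore-source : total (notBefore y) (star σ x) ≡ suc (startFan σ x x₁)
    notBefore-source = total-insert (star-unique σ x) (∈T⇒∈star xy) other (indicator-yes (y ℤ.≤? y) ℤ.≤-refl)
      where
      other : ∀ {d} → d ∈ star σ x → d ≢ across y → notBefore y d ≡ rightUpTo x₁ d
      other {left _} _ _ = refl
      other {across j} j∈ j≢y = indicator-no (y ℤ.≤? j) (λ y≤j →
        bridge-bridge σ (∈star⇒∈T j∈) landing x<x₁ (ℤ.≤∧≢⇒< y≤j λ { refl → j≢y refl }))
      other {right p} p∈ _ = sym (indicator-yes (p ℤ.≤? x₁) (furthest (∈star⇒∈T p∈)))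

    degree-source : length (star σ x) ≡ total (before y) (star σ x) ℕ.+ suc (startFan σ x x₁)
    degree-source = trans (total-complement (star σ x) λ
      { {left _} _ → refl
      ; {across j} _ → split j
      ; {right _} _ → refl }) (cong (total (before y) (star σ x) ℕ.+_) notBefore-source)
      where
      split : ∀ j → indicator (j ℤ.<? y) ℕ.+ indicator (y ℤ.≤? j) ≡ 1
      split j with j ℤ.<? y
      ... | yes j<y = cong suc (indicator-no (y ℤ.≤? j) (ℤ.<⇒≱ j<y))
      ... | no j≮y  = indicator-yes (y ℤ.≤? j) (ℤ.≮⇒≥ j≮y)

    module _ {a p : ℤ → ℤ} (deg : ∀ x → a x ≡ + suc (length (star σ x))) (sol : Solution a p) where

      -- The triangles at x are the 1 + B left of the bridge, the triangle of the step, and those of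
      -- the polygon below its base. The polygon relation removes the last group from the
      -- recurrence; the triangle of the step contributes the extra p x.
      step-value : p x₁ ≡ p x + across-value σ p x y
      step-value = begin
        p x₁                                                    ≡⟨ proj₁ (polygon σ deg sol edge) ⟩
        p (sucℤ x) - + startFan σ x x₁ * p x                    ≡⟨ cong (_- + startFan σ x x₁ * p x) (next sol x) ⟩
        a x * p x - p (pred x) - + startFan σ x x₁ * p x        ≡⟨ cong (λ k → k * p x - p (pred x) - + startFan σ x x₁ * p x) (trans (deg x) (cong (λ k → + suc k) degree-source)) ⟩
        (1ℤ + (+ B + (1ℤ + + startFan σ x x₁))) * p x - p (pred x) - + startFan σ x x₁ * p x
          ≡⟨ l (+ B) (+ startFan σ x x₁) (p x) (p (pred x)) ⟩
        p x + across-value σ p x y ∎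
        where
        open ≡-Reasoning
        B = total (before y) (star σ x)
        l : ∀ B S x x₋ → (1ℤ + (B + (1ℤ + S))) * x - x₋ - S * x ≡ x + ((1ℤ + B) * x - x₋)
        l = solve-∀

      -- Left of the new bridge, x₁ meets the triangle of the step and the polygon below its base,
      -- so the polygon relation at x₁ turns the new value into p x₁ - p x.
      step-across : across-value σ p x₁ y ≡ across-value σ p x y
      step-across = begin
        + suc (total (before y) (star σ x₁)) * p x₁ - p (pred x₁) ≡⟨ cong (λ k → + suc k * p x₁ - p (pred x₁)) before-target ⟩
        (1ℤ + + endFan σ x x₁) * p x₁ - p (pred x₁)                 ≡⟨ l (+ endFan σ x x₁) (p x₁) (p (pred x₁)) ⟩
        p x₁ - (p (pred x₁) - + endFan σ x x₁ * p x₁)               ≡⟨ cong₂ _-_ step-value (sym (proj₂ (polygon σ deg sol edge))) ⟩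
        p x + across-value σ p x y - p x                            ≡⟨ l′ (p x) (across-value σ p x y) ⟩
        across-value σ p x y ∎
        where
        open ≡-Reasoning
        l : ∀ E x x₋ → (1ℤ + E) * x - x₋ ≡ x - (x₋ - E * x)
        l = solve-∀
        l′ : ∀ x F → x + F - x ≡ F
        l′ = solve-∀

  -- Only the count at x changes: the old bridge now lies before the new one, and any further bridge
  -- in between would cross the base from y to y₁. The identity thus holds for every function p.
  opposite-step-across : ∀ σ {x y} → Bridge σ x y → (step : Step (opposite σ) y x) → ∀ p →
    across-value σ p x (Step.target step) ≡ across-value σ p x y + p x
  opposite-step-across σ {x} {y} xy step p = begin
    + suc (total (before y₁) (star σ x)) * p x - p (pred x) ≡⟨ cong (λ k → + suc k * p x - p (pred x)) before-step ⟩
    (1ℤ + (1ℤ + + B)) * p x - p (pred x)                      ≡⟨ l (+ B) (p x) (p (pred x)) ⟩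
    across-value σ p x y + p x ∎
    where
    open ≡-Reasoning
    open Step step renaming (target to y₁)
    y<y₁ = edge-< edge
    B = total (before y) (star σ x)
    l : ∀ B x x₋ → (1ℤ + (1ℤ + B)) * x - x₋ ≡ (1ℤ + B) * x - x₋ + x
    l = solve-∀
    other : ∀ {d} → d ∈ star σ x → d ≢ across y → before y₁ d ≡ before y d
    other {left _}  _ _ = refl
    other {right _} _ _ = refl
    other {across j} j∈ j≢y = indicator-cong (j ℤ.<? y₁) (j ℤ.<? y)
      (λ j<y₁ → ℤ.≰⇒> λ y≤j → edge-bridge (opposite σ) edge (flip σ (∈star⇒∈T j∈))
        (ℤ.≤∧≢⇒< y≤j λ { refl → j≢y refl }) j<y₁)
      (λ j<y → ℤ.<-trans j<y y<y₁)
    before-step : total (before y₁) (star σ x) ≡ suc B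
    before-step = total-insert (star-unique σ x) (∈T⇒∈star xy) other
      (trans (indicator-yes (y ℤ.<? y₁) y<y₁) (cong suc (sym (indicator-no (y ℤ.<? y) (ℤ.<-irrefl refl)))))

  -- The walk from a bridge to a later one

  next-step : ∀ {x y} → Bridge outer x y → Step outer x y ⊎ Step inner y x
  next-step {x} {y} xy with any? beyond? (star outer x)
    where
    Beyond : Direction → Set
    Beyond (across q) = y < q
    Beyond _          = ⊥
    beyond? : ∀ d → Dec (Beyond d)
    beyond? (left _)   = no λ ()
    beyond? (across q) = y ℤ.<? q
    beyond? (right _)  = no λ ()
  ... | no none = inj₁ (advance outer xy λ xq y<q → none (lose (∈T⇒∈star {outer} {d = across _} xq) y<q))
  ... | yes some with find some
  -- The bridge from x to q beyond y would be crossed by any bridge from y to a point beyond x, so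
  -- the triangle has its base on the inner line.
  ...   | across q , q∈ , y<q = inj₂ (advance inner xy λ py x<p → bridge-bridge outer (∈star⇒∈T q∈) py x<p y<q)

  -- No overshooting: a base reaching over X would cross the bridge at X. If x is already X, then y
  -- is before Y and the landing bridge would cross it instead.
  step-within : ∀ σ {x y X Y} → Bridge σ x y → Bridge σ X Y → x ℤ.≤ X → y ℤ.≤ Y → ¬ (x ≡ X × y ≡ Y) →
    (step : Step σ x y) → Step.target step ℤ.≤ X
  step-within σ {x} {y} {X} {Y} xy XY x≤X y≤Y apart step with x ℤ.≟ X
  ... | yes refl = ℤ.≮⇒≥ λ X<x₁ → bridge-bridge σ XY landing X<x₁ (ℤ.≤∧≢⇒< y≤Y λ { refl → apart (refl , refl) })
    where open Step step
  ... | no x≢X = ℤ.≮⇒≥ λ X<x₁ → edge-bridge σ edge XY (ℤ.≤∧≢⇒< x≤X x≢X) X<x₁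
    where open Step step

  module _ {a ā : ℤ → ℤ} (deg : ∀ x → a x ≡ + suc (length (star outer x)))
    (deḡ : ∀ y → ā y ≡ + suc (length (star inner y))) where

    -- The two lines swap the roles of a value and of its extension across, so
    -- the same matrix acts with its rows and columns exchanged.
    record Transfer (x y X Y : ℤ) : Set where
      field
        α β γ δ : ℤ
        outer-value  : ∀ {p} → Solution a p → p X ≡ α * p x + β * across-value outer p x y
        outer-across : ∀ {p} → Solution a p → across-value outer p X Y ≡ γ * p x + δ * across-value outer p x y
        inner-value  : ∀ {p} → Solution ā p → p Y ≡ δ * p y + γ * across-value inner p y x
        inner-across : ∀ {p} → Solution ā p → across-value inner p Y X ≡ β * p y + α * across-value inner p y x

    private
      id₁ : ∀ u v → u ≡ 1ℤ * u + 0ℤ * v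
      id₁ = solve-∀
      id₂ : ∀ u v → v ≡ 0ℤ * u + 1ℤ * v
      id₂ = solve-∀
      absorbˡ : ∀ α β u v → α * (u + v) + β * v ≡ α * u + (α + β) * v
      absorbˡ = solve-∀
      absorbʳ : ∀ α β u v → α * u + β * (v + u) ≡ (α + β) * u + β * v
      absorbʳ = solve-∀
      absorbʳ′ : ∀ α β u v → α * u + β * (v + u) ≡ (β + α) * u + β * v
      absorbʳ′ = solve-∀
      absorbˡ′ : ∀ α β u v → α * (u + v) + β * v ≡ α * u + (β + α) * v
      absorbˡ′ = solve-∀

    transfer-refl : ∀ {x y} → Transfer x y x y
    transfer-refl {x} {y} = record
      { α = 1ℤ ; β = 0ℤ ; γ = 0ℤ ; δ = 1ℤ
      ; outer-value  = λ {p} _ → id₁ (p x) (across-value outer p x y)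
      ; outer-across = λ {p} _ → id₂ (p x) (across-value outer p x y)
      ; inner-value  = λ {p} _ → id₁ (p y) (across-value inner p y x)
      ; inner-across = λ {p} _ → id₂ (p y) (across-value inner p y x) }

    -- The first step multiplies from the right: by (1 1 ; 0 1) for outer solutions and by (1 0 ; 1
    -- 1) for inner ones, which are exchanged by swapping both rows and columns.
    transfer-outer : ∀ {x y X Y} → Bridge outer x y → (step : Step outer x y) →
      Transfer (Step.target step) y X Y → Transfer x y X Y
    transfer-outer {x} {y} xy step t = record
      { α = α ; β = α + β ; γ = γ ; δ = γ + δ
      ; outer-value  = λ {p} s → trans (outer-value s)
          (trans (cong₂ (λ u v → α * u + β * v) (step-value outer xy step deg s) (step-across outer xy step deg s))
            (absorbˡ α β (p x) (across-value outer p x y)))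
      ; outer-across = λ {p} s → trans (outer-across s)
          (trans (cong₂ (λ u v → γ * u + δ * v) (step-value outer xy step deg s) (step-across outer xy step deg s))
            (absorbˡ γ δ (p x) (across-value outer p x y)))
      ; inner-value  = λ {p} s → trans (inner-value s)
          (trans (cong (λ v → δ * p y + γ * v) (opposite-step-across inner xy step p))
            (absorbʳ′ δ γ (p y) (across-value inner p y x)))
      ; inner-across = λ {p} s → trans (inner-across s)
          (trans (cong (λ v → β * p y + α * v) (opposite-step-across inner xy step p))
            (absorbʳ′ β α (p y) (across-value inner p y x))) }
      where open Transfer t

    transfer-inner : ∀ {x y X Y} → Bridge outer x y → (step : Step inner y x) →
      Transfer x (Step.target step) X Y → Transfer x y X Y
    transfer-inner {x} {y} xy step t = record
      { α = α + β ; β = β ; γ = γ + δ ; δ = δ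
      ; outer-value  = λ {p} s → trans (outer-value s)
          (trans (cong (λ v → α * p x + β * v) (opposite-step-across outer xy step p))
            (absorbʳ α β (p x) (across-value outer p x y)))
      ; outer-across = λ {p} s → trans (outer-across s)
          (trans (cong (λ v → γ * p x + δ * v) (opposite-step-across outer xy step p))
            (absorbʳ γ δ (p x) (across-value outer p x y)))
      ; inner-value  = λ {p} s → trans (inner-value s)
          (trans (cong₂ (λ u v → δ * u + γ * v) (step-value inner xy step deḡ s) (step-across inner xy step deḡ s))
            (absorbˡ′ δ γ (p y) (across-value inner p y x)))
      ; inner-across = λ {p} s → trans (inner-across s)
          (trans (cong₂ (λ u v → β * u + α * v) (step-value inner xy step deḡ s) (step-across inner xy step deḡ s))
            (absorbˡ′ β α (p y) (across-value inner p y x))) }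
      where open Transfer t

    -- Each step increases x + y while `step-within` keeps the walk from passing (X , Y), so it must
    -- end there; the fuel exceeds the remaining distance.
    transfer : ∀ fuel {x y X Y} → Bridge outer x y → Bridge outer X Y → x ℤ.≤ X → y ℤ.≤ Y →
      X + Y < x + y + + fuel → Transfer x y X Y
    transfer zero {x} {y} _ _ x≤X y≤Y h =
      ⊥-elim (ℤ.≤⇒≯ (ℤ.+-mono-≤ x≤X y≤Y) (subst (_ <_) (ℤ.+-identityʳ (x + y)) h))
    transfer (suc fuel) {x} {y} {X} {Y} xy XY x≤X y≤Y h with (x ℤ.≟ X) ×-dec (y ℤ.≟ Y)
    ... | yes (refl , refl) = transfer-refl
    ... | no apart with next-step xy
    ...   | inj₁ step = transfer-outer xy step
            (transfer fuel landing XY (step-within outer xy XY x≤X y≤Y apart step) y≤Y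
              (ℤ.<-≤-trans h (ℤ.≤-trans (ℤ.≤-reflexive (l x y (+ fuel)))
                (ℤ.+-monoˡ-≤ (+ fuel) (ℤ.+-monoˡ-≤ y (ℤ.i<j⇒suc[i]≤j (edge-< edge)))))))
      where open Step step
            l : ∀ x y f → x + y + (1ℤ + f) ≡ 1ℤ + x + y + f
            l = solve-∀
    ...   | inj₂ step = transfer-inner xy step
            (transfer fuel landing XY x≤X (step-within inner xy XY y≤Y x≤X (λ (e , e′) → apart (e′ , e)) step)
              (ℤ.<-≤-trans h (ℤ.≤-trans (ℤ.≤-reflexive (l x y (+ fuel)))
                (ℤ.+-monoˡ-≤ (+ fuel) (ℤ.+-monoʳ-≤ x (ℤ.i<j⇒suc[i]≤j (edge-< edge)))))))
      where open Step step
            l : ∀ x y f → x + y + (1ℤ + f) ≡ x + (1ℤ + y) + f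
            l = solve-∀

  -- Existence of a bridge

  span : Side → Curve n m → ℕ
  span outer (peripheral outer _ k _) = k
  span inner (peripheral inner _ k _) = k
  span _     _                        = 0

  chord-span : ∀ σ {p q t} γ → chord σ p q ≡ shift t (base γ) → q ≡ p + + span σ γ
  chord-span outer {t = t} (peripheral outer v k _) refl = l (label v) (+ k) (t * + n)
    where l : ∀ v k z → v + k + z ≡ v + z + k
          l = solve-∀
  chord-span inner {t = t} (peripheral inner v k _) refl = l (label v) (+ k) (t * + m)
    where l : ∀ v k z → v + k + z ≡ v + z + k
          l = solve-∀

  span-chord : ∀ σ γ → γ ∈ arcs → ∃ λ x → span σ γ ≡ 0 ⊎ Chord σ x (x + + span σ γ)
  span-chord outer γ@(peripheral outer v k _) γ∈ = label v , inj₂ (γ , γ∈ , 0ℤ , sym (shift-0 (base γ)))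
  span-chord inner γ@(peripheral inner v k _) γ∈ = label v , inj₂ (γ , γ∈ , 0ℤ , sym (shift-0 (base γ)))
  span-chord outer (peripheral inner _ _ _) _ = 0ℤ , inj₁ refl
  span-chord inner (peripheral outer _ _ _) _ = 0ℤ , inj₁ refl
  span-chord outer (bridging _ _) _ = 0ℤ , inj₁ refl
  span-chord inner (bridging _ _) _ = 0ℤ , inj₁ refl

  longest : ∀ (f : Curve n m → ℕ) l → l ≡ [] ⊎ ∃ λ γ → γ ∈ l × ∀ {δ} → δ ∈ l → f δ ℕ.≤ f γ
  longest f []      = inj₁ refl
  longest f (γ ∷ l) = inj₂ (argmax f γ l , member , λ
    { (here refl) → f[⊥]≤f[argmax] {f = f} γ l ; (there δ∈) → All.lookup (f[xs]≤f[argmax] {f = f} γ l) δ∈ })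
    where
    member : argmax f γ l ∈ γ ∷ l
    member with argmax-sel f γ l
    ... | inj₁ ≡γ = here ≡γ
    ... | inj₂ ∈l = there ∈l

  -- An endpoint of a longest chord.
  uncovered : ∀ σ → ∃ λ x → ∀ {p q} → Chord σ p q → p < x → x < q → ⊥
  uncovered σ with longest (span σ) arcs
  ... | inj₁ none = 0ℤ , λ { (γ , γ∈ , _) _ _ → none-in none γ∈ }
    where
    none-in : ∀ {γ : Curve n m} {l} → l ≡ [] → ¬ γ ∈ l
    none-in refl ()
  ... | inj₂ (γ , γ∈ , max) with span-chord σ γ γ∈
  -- If the maximal span is 0, the line carries no chords and any point will do.
  ...   | x , inj₁ span≡0 = x , λ { {p} {q} (δ , δ∈ , t , eq) p<x x<q →
            ℤ.<⇒≱ (ℤ.<-trans p<x x<q) (begin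
              q              ≡⟨ chord-span σ {t = t} δ eq ⟩
              p + + span σ δ ≤⟨ ℤ.+-monoʳ-≤ p (ℤ.+≤+ (max δ∈)) ⟩
              p + + span σ γ ≡⟨ cong (λ k → p + + k) span≡0 ⟩
              p + 0ℤ         ≡⟨ ℤ.+-identityʳ p ⟩
              p              ∎) }
    where open ℤ.≤-Reasoning
  ...   | x , inj₂ x-chord = x , λ { {p} {q} pq@(δ , δ∈ , t , eq) p<x x<q →
            chord-chord σ pq x-chord p<x x<q (begin-strict
              q              ≡⟨ chord-span σ {t = t} δ eq ⟩
              p + + span σ δ ≤⟨ ℤ.+-monoʳ-≤ p (ℤ.+≤+ (max δ∈)) ⟩
              p + + span σ γ <⟨ ℤ.+-monoˡ-< (+ span σ γ) p<x ⟩
              x + + span σ γ ∎) }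
    where open ℤ.≤-Reasoning

  -- A chord over the start of a longest chord would end before that chord does and so cross it.
  -- Without bridges, two such points on opposite lines can be joined, and maximality puts the
  -- joining bridge in T.
  some-bridge : ∃₂ λ x y → Bridge outer x y
  some-bridge with any? isBridging? arcs
    where
    isBridging? : ∀ γ → Dec (∃₂ λ x y → base γ ≡ bridge x y)
    isBridging? (peripheral _ _ _ _) = no λ ()
    isBridging? (bridging v j)       = yes (label v , j , refl)
  ... | yes some with find some
  ...   | γ , γ∈ , x , y , eq = x , y , γ , γ∈ , 0ℤ , trans (sym eq) (sym (shift-0 (base γ)))
  some-bridge | no none with uncovered outer | uncovered inner
  ...   | x , x-free | y , y-free = x , y , maximal-bridge outer x-free y-free
            (λ b _ _ → no-bridge b) (λ b _ _ → no-bridge b)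
    where
    no-bridge : ∀ {x y} → ¬ Bridge outer x y
    no-bridge (bridging v j , γ∈ , _) = none (lose γ∈ (label v , j , refl))

  -- One period of the walk and the two traces

  deck : Side → ℤ → ℤ
  deck σ x = x + 1ℤ * + N σ

  -- The coefficient f is the same at a bridge and at its translate, so start and end of the walk
  -- use the same form of coordinates, as `Monodromy.trace` requires.
  before-periodic : ∀ σ x y →
    total (before (deck (opposite σ) y)) (star σ (deck σ x)) ≡ total (before y) (star σ x)
  before-periodic σ x y = trans (cong (total (before (deck (opposite σ) y))) (star-periodic σ x))
    (trans (cong sum (sym (List.map-∘ (star σ x)))) (total-cong (star σ x) λ {d} _ → pointwise d))
    where
    M = 1ℤ * + N (opposite σ)
    cancel : ∀ {i j} → i + M < j + M → i < j
    cancel {i} {j} h = subst₂ _<_ (l i M) (l j M) (ℤ.+-monoˡ-< (- M) h)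
      where l : ∀ i M → i + M - M ≡ i
            l = solve-∀
    pointwise : ∀ d → before (deck (opposite σ) y) (shiftDirection σ 1ℤ d) ≡ before y d
    pointwise (left _)   = refl
    pointwise (across j) = indicator-cong (deck (opposite σ) j ℤ.<? deck (opposite σ) y) (j ℤ.<? y) cancel (ℤ.+-monoˡ-< M)
    pointwise (right _)  = refl

  module _ σ (F : InfiniteFrieze) (generated : F GeneratedBy quiddity T σ) where
    open InfiniteFrieze F using (quiddityRow)

    row-degree : ∀ x → quiddityRow x ≡ + suc (length (star σ x))
    row-degree x with reduce σ x
    ... | v , t , x≡ = trans (generated x v x∣v) (cong +_ (length-star σ v x x∣v))
      where
      x∣v : x LiesOver v
      x∣v = divides t (trans (cong (_- label v) x≡) (l (label v) (t * + N σ)))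
        where l : ∀ v z → v + z - v ≡ z
              l = solve-∀

    row-periodic : Periodic (+ N σ) quiddityRow
    row-periodic x = begin
      quiddityRow (x + + N σ)                        ≡⟨ cong (λ z → quiddityRow (x + z)) (ℤ.*-identityˡ (+ N σ)) ⟨
      quiddityRow (deck σ x)                         ≡⟨ row-degree (deck σ x) ⟩
      + suc (length (star σ (deck σ x)))           ≡⟨ cong (λ l → + suc (length l)) (star-periodic σ x) ⟩
      + suc (length (map (shiftDirection σ 1ℤ) (star σ x))) ≡⟨ cong (λ k → + suc k) (List.length-map _ (star σ x)) ⟩
      + suc (length (star σ x))                    ≡⟨ row-degree x ⟨
      quiddityRow x                                  ∎
      where open ≡-Reasoning

    frieze-trace : ∀ x y α β γ δ →
      (∀ {p} → Solution quiddityRow p → p (deck σ x) ≡ α * p x + β * across-value σ p x y) →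
      (∀ {p} → Solution quiddityRow p → across-value σ p (deck σ x) (deck (opposite σ) y) ≡ γ * p x + δ * across-value σ p x y) →
      α + δ ≡ s (N σ) F
    frieze-trace x y α β γ δ h₁ h₂ =
      trans (Monodromy.trace row-periodic x f {α} {β} {γ} {δ} h₁′ h₂′) (s-trace (N σ) (size≢0 σ))
      where
      f = + suc (total (before y) (star σ x))
      deck≡ : deck σ x ≡ x + + N σ
      deck≡ = cong (_+_ x) (ℤ.*-identityˡ (+ N σ))
      h₁′ : ∀ p → Solution quiddityRow p → p (x + + N σ) ≡ α * p x + β * (f * p x - p (pred x))
      h₁′ p sol = trans (cong p (sym deck≡)) (h₁ sol)
      h₂′ : ∀ p → Solution quiddityRow p →
        f * p (x + + N σ) - p (pred (x + + N σ)) ≡ γ * p x + δ * (f * p x - p (pred x))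
      h₂′ p sol = trans (cong (λ z → f * p z - p (pred z)) (sym deck≡))
        (trans (cong (λ k → + suc k * p (deck σ x) - p (pred (deck σ x))) (sym (before-periodic σ x y))) (h₂ sol))
      s-trace : ∀ k → ℕ.NonZero k → solution quiddityRow 0ℤ 1ℤ (1ℤ + + k) + solution quiddityRow 1ℤ 0ℤ (0ℤ + + k) ≡ s k F
      s-trace (suc k) _ = sym (Rows.s-as-trace F k)

  s-outer≡s-inner : (F F̄ : InfiniteFrieze) → F GeneratedBy quiddity T outer → F̄ GeneratedBy quiddity T inner →
    s n F ≡ s m F̄
  s-outer≡s-inner F F̄ gen gen̄ with some-bridge
  ... | x , y , xy = begin
      s n F          ≡⟨ frieze-trace outer F gen x y α β γ δ outer-value outer-across ⟨
      α + δ          ≡⟨ ℤ.+-comm α δ ⟩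
      δ + α          ≡⟨ frieze-trace inner F̄ gen̄ y x δ γ β α inner-value inner-across ⟩
      s m F̄          ∎
    where
    open ≡-Reasoning
    forward : ∀ σ x → x ℤ.≤ deck σ x
    forward σ x = subst (λ z → x ℤ.≤ x + z) (sym (ℤ.*-identityˡ (+ N σ))) (ℤ.i≤i+j x (+ N σ))
    -- The translate is at distance n + m from the bridge; the additional 1 makes the bound strict.
    bound : deck outer x + deck inner y < x + y + + suc (n ℕ.+ m)
    bound = subst (_< x + y + + suc (n ℕ.+ m)) (l x y (+ n) (+ m)) (ℤ.+-monoʳ-< (x + y) (ℤ.+<+ (ℕ.n<1+n (n ℕ.+ m))))
      where l : ∀ x y n m → x + y + (n + m) ≡ x + 1ℤ * n + (y + 1ℤ * m)
            l = solve-∀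
    open Transfer (transfer (row-degree outer F gen) (row-degree inner F̄ gen̄) (suc (n ℕ.+ m))
      xy (∈T-shift 1ℤ xy) (forward outer x) (forward inner y) bound)

theorem3p4 : (n m : ℕ) → 1 ≤ n → 1 ≤ m →
    (T : Triangulation n m) (F F̄ : InfiniteFrieze) →
    F GeneratedBy (outerQuiddity T) → F̄ GeneratedBy (innerQuiddity T) →
    s n F ≡ s m F̄
theorem3p4 n m 1≤n 1≤m T F F̄ = s-outer≡s-inner ⦃ ℕ.>-nonZero 1≤n ⦄ ⦃ ℕ.>-nonZero 1≤m ⦄ T F F̄
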